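{- Let $m\geq 2$ and $n\geq 1$ be integers. Write $$\big(P_{m,n}(x)\big)^2=x^k+\sum_{i=0}^{k-1}b_ix^i\quad\text{and}\quad P_{m+1,n}(x)=x^\ell+\sum_{i=0}^{\ell-1}c_ix^i,$$ where $k=2\deg(P_{m,n})=2\deg(G_{m,n})$ and $\ell=\deg(P_{m+1,n})=\deg(G_{m+1,n})$. Then for each integer $i\geq 1$ such that $\lfloor ni/2\rfloor\leq 2^{m-2}-2$, we have $b_{k-i}=c_{\ell-i}$.
   Context: Let $a_i=a_i(c)\in\mathbb{Z}[c]$ be defined by $a_0=0$ and $a_i=a_{i-1}^2+c$ (i.e. $a_i=f_c^i(0)$ with $f_c(z)=z^2+c$). $\mu$ is the Möbius function. For $m\geq 2$, $n\geq 1$, $G_{m,n}\in\mathbb{Z}[c]$ is $\prod_{k\mid n}(a_{m+k-1}+a_{m-1})^{\mu(n/k)}$ if $n\nmid m-1$, and $\prod_{k\mid n}(a_{m+k-1}+a_{m-1})^{\mu(n/k)}\prod_{k\mid n}a_k^{ -\mu(n/k)}$ if $n\mid m-1$ (a monic integer polynomial). For a root $\alpha$ of $G_{m,n}$, $\lambda_{m,n}(\alpha)=2^n\prod_{i=0}^{n-1}a_{m+i}(\alpha)$, and the multiplier polynomial is $P_{m,n}(x)=\prod_j(x-\lambda_{m,n}(\alpha_j))\in\mathbb{Z}[x]$, the product over all roots $\alpha_j$ of $G_{m,n}$ with multiplicity. -}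

module Defs where

open import Level using (Level)
open import Algebra.Bundles using (CommutativeRing)
open import Data.Bool using (Bool; true; false; if_then_else_)
open import Data.Nat as ℕ using (ℕ; zero; suc; _≤ᵇ_; _≤?_)
open import Data.Nat.DivMod using (_/_)
open import Data.Nat.Divisibility using (_∣_; _∣?_)
open import Data.Nat.Primality using (prime?)
open import Data.Integer as ℤ using (ℤ; +_)
open import Data.List using (List; []; _∷_; map; foldr; filter; upTo; length)
open import Data.Bool.ListAction using (any)
open import Data.Product using (_×_; _,_)
open import Data.Sum using (_⊎_)
open import Relation.Nullary using (¬_; does)
open import Relation.Nullary.Decidable using (_×-dec_)

-- Möbius function on ℕ (only used for arguments ≥ 1).
-- μ(n) = 0 if d² ∣ n for some d ≥ 2, otherwise (-1)^(number of prime divisors of n).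

hasSquareFactor : ℕ → Bool
hasSquareFactor n = any (λ d → (2 ≤ᵇ d) Data.Bool.∧ does (d ℕ.* d ∣? n)) (upTo (suc n))

primeDivisorCount : ℕ → ℕ
primeDivisorCount n = length (filter (λ p → prime? p ×-dec (p ∣? n)) (upTo (suc n)))

μ : ℕ → ℤ
μ n = if hasSquareFactor n then + 0 else ((ℤ.- + 1) ℤ.^ primeDivisorCount n)

divisorIdx : ℕ → List ℕ
divisorIdx n = filter (λ j → suc j ∣? n) (upTo n)

divIdxμ+ divIdxμ- : ℕ → List ℕ
divIdxμ+ n = filter (λ j → μ (n / suc j) ℤ.≟ + 1) (divisorIdx n)
divIdxμ- n = filter (λ j → μ (n / suc j) ℤ.≟ ℤ.- + 1) (divisorIdx n)

-- Polynomials over a commutative ring, as coefficient lists (lowest degree first).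

module Poly {c ℓ : Level} (R : CommutativeRing c ℓ) where
  open CommutativeRing R public

  Pol : Set c
  Pol = List Carrier

  infixl 6 _+ₚ_
  infixl 7 _*ₚ_

  _+ₚ_ : Pol → Pol → Pol
  [] +ₚ q = q
  (a ∷ p) +ₚ [] = a ∷ p
  (a ∷ p) +ₚ (b ∷ q) = (a + b) ∷ (p +ₚ q)

  _*ₚ_ : Pol → Pol → Pol
  [] *ₚ q = []
  (a ∷ p) *ₚ q = map (a *_) q +ₚ (0# ∷ (p *ₚ q))

  oneₚ : Pol
  oneₚ = 1# ∷ []

  Xₚ : Pol
  Xₚ = 0# ∷ 1# ∷ []

  X-_ : Carrier → Pol
  X- a = (- a) ∷ 1# ∷ []

  prodₚ : List Pol → Pol
  prodₚ = foldr _*ₚ_ oneₚ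

  coeff : Pol → ℕ → Carrier
  coeff [] i = 0#
  coeff (a ∷ p) zero = a
  coeff (a ∷ p) (suc i) = coeff p i

  -- equality of polynomials (coefficientwise, so trailing zeros are irrelevant)
  _≈ₚ_ : Pol → Pol → Set ℓ
  p ≈ₚ q = ∀ i → coeff p i ≈ coeff q i

  coeffTop : Pol → ℕ → ℕ → Carrier
  coeffTop p d i = if i ≤ᵇ d then coeff p (d ℕ.∸ i) else 0#

  -- a_i(c) = f_c^i(0) as a polynomial in c
  aₚ : ℕ → Pol
  aₚ zero = []
  aₚ (suc i) = aₚ i *ₚ aₚ i +ₚ Xₚ

  aEval : ℕ → Carrier → Carrier
  aEval zero α = 0#
  aEval (suc i) α = aEval i α * aEval i α + α

  pow : Carrier → ℕ → Carrier
  pow x zero = 1#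
  pow x (suc k) = x * pow x k

  -- G_{m,n} = Num / Den, where
  --   Num = ∏_{k|n, μ(n/k)=1} (a_{m+k-1}+a_{m-1}) · [n | m-1] ∏_{k|n, μ(n/k)=-1} a_k
  --   Den = ∏_{k|n, μ(n/k)=-1} (a_{m+k-1}+a_{m-1}) · [n | m-1] ∏_{k|n, μ(n/k)=1} a_k
  -- (k = j+1 below)

  factorₚ : ℕ → ℕ → Pol
  factorₚ m j = aₚ (m ℕ.+ j) +ₚ aₚ (m ℕ.∸ 1)

  extraₚ : ℕ → ℕ → List ℕ → Pol
  extraₚ m n js = if does (n ∣? (m ℕ.∸ 1)) then prodₚ (map (λ j → aₚ (suc j)) js) else oneₚ

  Numₚ Denₚ : ℕ → ℕ → Pol
  Numₚ m n = prodₚ (map (factorₚ m) (divIdxμ+ n)) *ₚ extraₚ m n (divIdxμ- n)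
  Denₚ m n = prodₚ (map (factorₚ m) (divIdxμ- n)) *ₚ extraₚ m n (divIdxμ+ n)

  -- "αs is the list of roots of G_{m,n} (with multiplicity)":
  --   G_{m,n}(c) = ∏_j (c - α_j), i.e. ∏_j (c - α_j) · Den = Num in R[c]
  RootsOfG : ℕ → ℕ → List Carrier → Set ℓ
  RootsOfG m n αs = (prodₚ (map X-_ αs) *ₚ Denₚ m n) ≈ₚ Numₚ m n

  multiplier : ℕ → ℕ → Carrier → Carrier
  multiplier m n α = pow (1# + 1#) n * foldr _*_ 1# (map (λ i → aEval (m ℕ.+ i) α) (upTo n))

  Pmult : ℕ → ℕ → List Carrier → Pol
  Pmult m n αs = prodₚ (map (λ α → X- (multiplier m n α)) αs)

  IsIntegralDomain : Set (c Level.⊔ ℓ)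
  IsIntegralDomain = (¬ (1# ≈ 0#)) × (∀ x y → x * y ≈ 0# → x ≈ 0# ⊎ y ≈ 0#)

  natCast : ℕ → Carrier
  natCast zero = 0#
  natCast (suc k) = 1# + natCast k

  CharZero : Set ℓ
  CharZero = ∀ k → ¬ (natCast (suc k) ≈ 0#)

module Submission where

-- Write p = m − 1. For monic B, the sum of g over the roots of B is the constant term at infinity of
-- g θB / B, where θ = c d/dc; it is additive in B, depends only on g modulo B, and is defined without
-- splitting B. By Newton's identities it suffices that the power sums Σ λ^i double from m to m + 1.
-- The factors a_k with n ∣ m − 1 contribute nothing because a_k divides λ, so the claim reduces to
-- each factor H = a_{p+k} + a_p with k ∣ n. Modulo H, the polynomial λ_{m,n} is a constant times the
-- power (w_0 ⋯ w_{k−1})^{n/k} with w_j = a_{p+j}, where w_j² = w_{j+1} − c and w_{k−1}² ≡ − w_0 − c.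
-- These relations do not mention m and reduce λ^i to combinations of c^d w_S with S ⊆ {0, …, k−1} and
-- 2d ≤ ni. For d ≤ 2^(m−2) − 2, comparing degrees at infinity shows that the sum of c^d w_S over the
-- roots of H doubles: a_{j+1} = a_j² + c may be replaced by a_j², and H by a_{p+k}, except when S is
-- everything, where the correction is the difference of the sums of c^d over the roots of a_p and a_{p+k}.

-- Only the roots of G are given in the ring; the numerator and denominator of G need not split
-- there, and no extension is built. Hence the sums over roots are taken at infinity, where they are
-- additive, and the sum over the roots of G is reached as numerator minus denominator. The factor 2
-- has one source: a_{j+1} is close to a_j², and the roots of a_j² are those of a_j counted twice.
-- The bound comes from degrees. The full product w_0 ⋯ w_{k-1} has degree deg a_{p+k} - deg a_p, so
-- c^d times it stays below deg a_{p+k} by 2^(m-2) - d, where 2^(m-2) = deg a_p. Two units must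
-- remain: one for the term c dropped from a_j² + c, one because the comparison is strict. To
-- control d, give c weight 2 and each w_j weight 1: no relation raises the weight, and λ^i starts
-- with weight ni. A proper subset S lacks a factor of degree at least deg a_p, which pays for
-- dropping a_p from H. The full set is the borderline case: a_p is no longer negligible there, but
-- the correction it causes is itself made of sums that double.

open import Defs
open import Level using (Level; _⊔_)
open import Algebra.Bundles using (CommutativeRing; RawRing)
import Algebra.Properties.CommutativeSemiring.Exp as Exp
import Algebra.Properties.Ring as RingProperties
import Algebra.Properties.Semiring.Mult as Mult
import Algebra.Solver.Ring as RingSolver
open import Algebra.Solver.Ring.AlmostCommutativeRing
  using (AlmostCommutativeRing; fromCommutativeRing; -raw-almostCommutative⟶; _-Raw-AlmostCommutative⟶_)
open import Data.Bool using (true; false; if_then_else_; T)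
open import Data.Empty using (⊥-elim)
open import Data.List using (List; []; _∷_; _++_; _∷ʳ_; map; length; foldr; upTo; replicate)
import Data.List.Properties as Listₚ
open import Data.List.Relation.Unary.All as All using (All; []; _∷_)
import Data.List.Relation.Unary.All.Properties as Allₚ
open import Data.Maybe using (nothing; just; Maybe)
open import Data.Nat as ℕ using (ℕ; zero; suc; z≤n; s≤s; _≤_; _<_)
open import Data.Nat.Divisibility using (_∣_; _∣?_; divides; ∣m∣n⇒∣m+n; ∣-trans)
open import Data.Nat.DivMod using (_/_; m*n/n≡m; /-monoˡ-≤)
open import Data.Nat.ListAction using (sum)
import Data.Nat.Properties as ℕₚ
import Data.Nat.Tactic.RingSolver as ℕSolver
open import Data.Product using (_×_; _,_; proj₁; proj₂; ∃)
open import Data.Sum using (_⊎_; inj₁; inj₂)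
open import Relation.Binary.Definitions using (tri<; tri≈; tri>)
import Relation.Binary.PropositionalEquality as ≡
open ≡ using (_≡_)
open import Relation.Nullary using (yes; no; ¬_; does)

-- Integer coefficients are represented by formal differences (a , b) = a − b.

module IntegerSolver {c ℓ} (R : CommutativeRing c ℓ) where
  open CommutativeRing R
  open Mult semiring using (×-homo-+; ×1-homo-*) renaming (_×_ to _·_)
  open import Relation.Binary.Reasoning.Setoid setoid

  private
    A : AlmostCommutativeRing c ℓ
    A = fromCommutativeRing R

    module Plain = RingSolver (AlmostCommutativeRing.rawRing A) A (-raw-almostCommutative⟶ A)
                     (λ _ _ → nothing)

    Diff : RawRing _ _
    Diff = record
      { Carrier = ℕ × ℕ
      ; _≈_ = _≡_
      ; _+_ = λ (a , b) (a′ , b′) → a ℕ.+ a′ , b ℕ.+ b′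
      ; _*_ = λ (a , b) (a′ , b′) → a ℕ.* a′ ℕ.+ b ℕ.* b′ , a ℕ.* b′ ℕ.+ b ℕ.* a′
      ; -_ = λ (a , b) → b , a
      ; 0# = 0 , 0
      ; 1# = 1 , 0
      }

    ⟦_⟧ : ℕ → Carrier
    ⟦ a ⟧ = a · 1#

    +-interchange : ∀ x y z w → (x + y) + - (z + w) ≈ (x + - z) + (y + - w)
    +-interchange = Plain.solve 4 (λ x y z w →
      (x Plain.:+ y) Plain.:+ Plain.:- (z Plain.:+ w) Plain.:= (x Plain.:+ Plain.:- z) Plain.:+ (y Plain.:+ Plain.:- w)) refl

    *-interchange : ∀ x y z w → (x * y + z * w) + - (x * w + z * y) ≈ (x + - z) * (y + - w)
    *-interchange x y z w = sym (begin
      (x + - z) * (y + - w)                             ≈⟨ distribʳ _ _ _ ⟩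
      x * (y + - w) + - z * (y + - w)                   ≈⟨ +-cong (distribˡ _ _ _) (distribˡ _ _ _) ⟩
      (x * y + x * - w) + (- z * y + - z * - w)         ≈⟨ +-cong (+-congˡ (-‿distribʳ-* x w)) (+-comm _ _) ⟨
      (x * y + - (x * w)) + (- z * - w + - z * y)       ≈⟨ +-congˡ (+-cong neg*neg (-‿distribˡ-* z y)) ⟨
      (x * y + - (x * w)) + (z * w + - (z * y))         ≈⟨ +-interchange _ _ _ _ ⟨
      (x * y + z * w) + - (x * w + z * y)               ∎)
      where
      open RingProperties ring
      neg*neg : z * w ≈ - z * - w
      neg*neg = begin
        z * w          ≈⟨ -‿involutive _ ⟨
        - - (z * w)    ≈⟨ -‿cong (-‿distribˡ-* z w) ⟩
        - (- z * w)    ≈⟨ -‿distribʳ-* (- z) w ⟩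
        - z * - w      ∎

    neg-swap : ∀ x y → x + - y ≈ - (y + - x)
    neg-swap x y = sym (begin
      - (y + - x)     ≈⟨ RingProperties.-‿+-comm ring y (- x) ⟨
      - y + - (- x)   ≈⟨ +-congˡ (RingProperties.-‿involutive ring x) ⟩
      - y + x         ≈⟨ +-comm _ _ ⟩
      x + - y         ∎)

    ⟦+⟧ : ∀ a b → ⟦ a ℕ.+ b ⟧ ≈ ⟦ a ⟧ + ⟦ b ⟧
    ⟦+⟧ a b = ×-homo-+ 1# a b

    ⟦*+*⟧ : ∀ a b a′ b′ → ⟦ a ℕ.* b ℕ.+ a′ ℕ.* b′ ⟧ ≈ ⟦ a ⟧ * ⟦ b ⟧ + ⟦ a′ ⟧ * ⟦ b′ ⟧
    ⟦*+*⟧ a b a′ b′ = trans (⟦+⟧ (a ℕ.* b) (a′ ℕ.* b′)) (+-cong (×1-homo-* a b) (×1-homo-* a′ b′))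

    -- The clauses for 0 and 1 make :0 and :1 denote 0# and 1# definitionally.
    value : ℕ × ℕ → Carrier
    value (0 , 0) = 0#
    value (1 , 0) = 1#
    value (a , b) = ⟦ a ⟧ + - ⟦ b ⟧

    value≈ : ∀ x → value x ≈ ⟦ proj₁ x ⟧ + - ⟦ proj₂ x ⟧
    value≈ (0 , 0) = sym (-‿inverseʳ 0#)
    value≈ (1 , 0) = sym (trans (+-cong (+-identityʳ 1#) (RingProperties.-0#≈0# ring)) (+-identityʳ 1#))
    value≈ (0 , suc b) = refl
    value≈ (1 , suc b) = refl
    value≈ (suc (suc a) , b) = refl

    morphism : Diff -Raw-AlmostCommutative⟶ A
    morphism = record
      { ⟦_⟧ = value
      ; +-homo = λ x@(a , b) y@(a′ , b′) → trans (value≈ (a ℕ.+ a′ , b ℕ.+ b′))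
          (trans (+-cong (⟦+⟧ a a′) (-‿cong (⟦+⟧ b b′)))
          (trans (+-interchange _ _ _ _) (sym (+-cong (value≈ x) (value≈ y)))))
      ; *-homo = λ x@(a , b) y@(a′ , b′) → trans (value≈ (a ℕ.* a′ ℕ.+ b ℕ.* b′ , a ℕ.* b′ ℕ.+ b ℕ.* a′))
          (trans (+-cong (⟦*+*⟧ a a′ b b′) (-‿cong (⟦*+*⟧ a b′ b a′)))
          (trans (*-interchange _ _ _ _) (sym (*-cong (value≈ x) (value≈ y)))))
      ; -‿homo = λ x@(a , b) → trans (value≈ (b , a)) (trans (neg-swap _ _) (-‿cong (sym (value≈ x))))
      ; 0-homo = refl
      ; 1-homo = refl
      }

    _≟_ : (x y : ℕ × ℕ) → Maybe (value x ≈ value y)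
    x@(a , b) ≟ y@(a′ , b′) with a ℕ.+ b′ ℕ.≟ a′ ℕ.+ b
    ... | no _ = nothing
    ... | yes eq = just (begin
      value x                                 ≈⟨ value≈ x ⟩
      ⟦ a ⟧ + - ⟦ b ⟧                         ≈⟨ cancel _ _ _ ⟨
      (⟦ a ⟧ + ⟦ b′ ⟧) + - (⟦ b ⟧ + ⟦ b′ ⟧)   ≈⟨ +-congʳ (⟦+⟧ a b′) ⟨
      ⟦ a ℕ.+ b′ ⟧ + - (⟦ b ⟧ + ⟦ b′ ⟧)       ≡⟨ ≡.cong (λ z → ⟦ z ⟧ + - (⟦ b ⟧ + ⟦ b′ ⟧)) eq ⟩
      ⟦ a′ ℕ.+ b ⟧ + - (⟦ b ⟧ + ⟦ b′ ⟧)       ≈⟨ +-cong (⟦+⟧ a′ b) (-‿cong (+-comm _ _)) ⟩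
      (⟦ a′ ⟧ + ⟦ b ⟧) + - (⟦ b′ ⟧ + ⟦ b ⟧)   ≈⟨ cancel _ _ _ ⟩
      ⟦ a′ ⟧ + - ⟦ b′ ⟧                       ≈⟨ value≈ y ⟨
      value y                                 ∎)
      where
      cancel : ∀ x y z → (x + z) + - (y + z) ≈ x + - y
      cancel x y z = begin
        (x + z) + - (y + z)   ≈⟨ +-interchange _ _ _ _ ⟩
        (x + - y) + (z + - z) ≈⟨ +-congˡ (-‿inverseʳ z) ⟩
        (x + - y) + 0#        ≈⟨ +-identityʳ _ ⟩
        x + - y               ∎

  open RingSolver Diff A morphism _≟_ public
    using (solve; _:=_; _:+_; _:*_; :-_; con; Polynomial)

  :0 :1 : ∀ {n} → Polynomial n
  :0 = con (0 , 0)
  :1 = con (1 , 0)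

-- Coefficient lists form a commutative ring.

module PolynomialRing {c ℓ} (R : CommutativeRing c ℓ) where
  open Poly R
  open IntegerSolver R
  open import Relation.Binary.Reasoning.Setoid setoid

  -- A record, unlike _≈ₚ_, lets the two polynomials be inferred from the type.

  infix 4 _≋_
  record _≋_ (p q : Pol) : Set ℓ where
    constructor coeffwise
    field at : ∀ i → coeff p i ≈ coeff q i
  open _≋_ public

  -ₚ_ : Pol → Pol
  -ₚ p = map -_ p

  coeff-+ : ∀ p q i → coeff (p +ₚ q) i ≈ coeff p i + coeff q i
  coeff-+ [] q i = sym (+-identityˡ _)
  coeff-+ (a ∷ p) [] i = sym (+-identityʳ _)
  coeff-+ (a ∷ p) (b ∷ q) zero = refl
  coeff-+ (a ∷ p) (b ∷ q) (suc i) = coeff-+ p q i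

  coeff-scale : ∀ a p i → coeff (map (a *_) p) i ≈ a * coeff p i
  coeff-scale a [] i = sym (zeroʳ a)
  coeff-scale a (b ∷ p) zero = refl
  coeff-scale a (b ∷ p) (suc i) = coeff-scale a p i

  coeff-neg : ∀ p i → coeff (-ₚ p) i ≈ - coeff p i
  coeff-neg [] i = sym (RingProperties.-0#≈0# ring)
  coeff-neg (b ∷ p) zero = refl
  coeff-neg (b ∷ p) (suc i) = coeff-neg p i

  -- The Cauchy product is taken on coefficient functions rather than lists, which keeps list
  -- lengths and trailing zeros out of the ring laws.
  conv : (f g : ℕ → Carrier) → ℕ → Carrier
  conv f g zero = f 0 * g 0
  conv f g (suc i) = f 0 * g (suc i) + conv (λ j → f (suc j)) g i

  conv-cong : ∀ {f f′ g g′} → (∀ i → f i ≈ f′ i) → (∀ i → g i ≈ g′ i) → ∀ i → conv f g i ≈ conv f′ g′ i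
  conv-cong f≈ g≈ zero = *-cong (f≈ 0) (g≈ 0)
  conv-cong f≈ g≈ (suc i) = +-cong (*-cong (f≈ 0) (g≈ (suc i))) (conv-cong (λ j → f≈ (suc j)) g≈ i)

  conv-zeroˡ : ∀ {f} g → (∀ i → f i ≈ 0#) → ∀ i → conv f g i ≈ 0#
  conv-zeroˡ g f≈0 zero = trans (*-congʳ (f≈0 0)) (zeroˡ _)
  conv-zeroˡ g f≈0 (suc i) =
    trans (+-cong (trans (*-congʳ (f≈0 0)) (zeroˡ _)) (conv-zeroˡ g (λ j → f≈0 (suc j)) i)) (+-identityˡ 0#)

  conv-distribʳ : ∀ f f′ g i → conv (λ j → f j + f′ j) g i ≈ conv f g i + conv f′ g i
  conv-distribʳ f f′ g zero = distribʳ _ _ _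
  conv-distribʳ f f′ g (suc i) = trans (+-congˡ (conv-distribʳ _ _ g i))
    (solve 5 (λ a b x u v → (a :+ b) :* x :+ (u :+ v) := (a :* x :+ u) :+ (b :* x :+ v)) refl _ _ _ _ _)

  conv-scale : ∀ a f g i → conv (λ j → a * f j) g i ≈ a * conv f g i
  conv-scale a f g zero = *-assoc _ _ _
  conv-scale a f g (suc i) = trans (+-cong (*-assoc _ _ _) (conv-scale a _ g i)) (sym (distribˡ _ _ _))

  -- The mirror image of the defining recursion, peeling off the second factor; with it
  -- commutativity becomes an induction.
  conv-sucʳ : ∀ f g i → conv f g (suc i) ≈ conv f (λ j → g (suc j)) i + f (suc i) * g 0
  conv-sucʳ f g zero = refl
  conv-sucʳ f g (suc i) = trans (+-congˡ (conv-sucʳ (λ j → f (suc j)) g i)) (sym (+-assoc _ _ _))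

  conv-comm : ∀ f g i → conv f g i ≈ conv g f i
  conv-comm f g zero = *-comm _ _
  conv-comm f g (suc i) = trans (conv-sucʳ f g i)
    (trans (+-comm _ _) (+-cong (*-comm _ _) (conv-comm f (λ j → g (suc j)) i)))

  conv-assoc : ∀ f g h i → conv (conv f g) h i ≈ conv f (conv g h) i
  conv-assoc f g h zero = *-assoc _ _ _
  conv-assoc f g h (suc i) = begin
    (f 0 * g 0) * h (suc i) + conv (λ j → f 0 * g (suc j) + conv f′ g j) h i
      ≈⟨ +-congˡ (conv-distribʳ _ _ h i) ⟩
    (f 0 * g 0) * h (suc i) + (conv (λ j → f 0 * g′ j) h i + conv (conv f′ g) h i)
      ≈⟨ +-congˡ (+-cong (conv-scale (f 0) g′ h i) (conv-assoc f′ g h i)) ⟩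
    (f 0 * g 0) * h (suc i) + (f 0 * conv g′ h i + conv f′ (conv g h) i)
      ≈⟨ solve 5 (λ a b x u v → a :* b :* x :+ (a :* u :+ v) := a :* (b :* x :+ u) :+ v) refl _ _ _ _ _ ⟩
    f 0 * (g 0 * h (suc i) + conv g′ h i) + conv f′ (conv g h) i ∎
    where
    f′ g′ : ℕ → Carrier
    f′ j = f (suc j)
    g′ j = g (suc j)

  coeff-* : ∀ p q i → coeff (p *ₚ q) i ≈ conv (coeff p) (coeff q) i
  coeff-* [] q i = sym (conv-zeroˡ (coeff q) (λ _ → refl) i)
  coeff-* (a ∷ p) q zero =
    trans (coeff-+ (map (a *_) q) _ 0) (trans (+-identityʳ _) (coeff-scale a q 0))
  coeff-* (a ∷ p) q (suc i) =
    trans (coeff-+ (map (a *_) q) _ (suc i)) (+-cong (coeff-scale a q (suc i)) (coeff-* p q i))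

  polynomialRing : CommutativeRing c ℓ
  polynomialRing = record
    { Carrier = Pol
    ; _≈_ = _≋_
    ; _+_ = _+ₚ_
    ; _*_ = _*ₚ_
    ; -_ = -ₚ_
    ; 0# = []
    ; 1# = oneₚ
    ; isCommutativeRing = record
      { isRing = record
        { +-isAbelianGroup = record
          { isGroup = record
            { isMonoid = record
              { isSemigroup = record
                { isMagma = record
                  { isEquivalence = record
                    { refl = coeffwise (λ _ → refl)
                    ; sym = λ e → coeffwise (λ i → sym (at e i))
                    ; trans = λ e f → coeffwise (λ i → trans (at e i) (at f i))
                    }
                  ; ∙-cong = λ {p} {p′} {q} {q′} e f → coeffwise λ i →
                      trans (coeff-+ p q i) (trans (+-cong (at e i) (at f i)) (sym (coeff-+ p′ q′ i)))
                  }
                ; assoc = λ p q r → coeffwise λ i → begin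
                    coeff ((p +ₚ q) +ₚ r) i            ≈⟨ trans (coeff-+ (p +ₚ q) r i) (+-congʳ (coeff-+ p q i)) ⟩
                    coeff p i + coeff q i + coeff r i  ≈⟨ +-assoc _ _ _ ⟩
                    coeff p i + (coeff q i + coeff r i) ≈⟨ trans (coeff-+ p (q +ₚ r) i) (+-congˡ (coeff-+ q r i)) ⟨
                    coeff (p +ₚ (q +ₚ r)) i            ∎
                }
              ; identity = (λ p → coeffwise λ i → refl)
                         , (λ p → coeffwise λ i → trans (coeff-+ p [] i) (+-identityʳ _))
              }
            ; inverse = (λ p → coeffwise λ i → trans (coeff-+ (-ₚ p) p i) (trans (+-congʳ (coeff-neg p i)) (-‿inverseˡ _)))
                      , (λ p → coeffwise λ i → trans (coeff-+ p (-ₚ p) i) (trans (+-congˡ (coeff-neg p i)) (-‿inverseʳ _)))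
            ; ⁻¹-cong = λ {p} {q} e → coeffwise λ i →
                trans (coeff-neg p i) (trans (-‿cong (at e i)) (sym (coeff-neg q i)))
            }
          ; comm = λ p q → coeffwise λ i →
              trans (coeff-+ p q i) (trans (+-comm _ _) (sym (coeff-+ q p i)))
          }
        ; *-cong = λ {p} {p′} {q} {q′} e f → coeffwise λ i →
            trans (coeff-* p q i) (trans (conv-cong (at e) (at f) i) (sym (coeff-* p′ q′ i)))
        ; *-assoc = λ p q r → coeffwise λ i → begin
            coeff ((p *ₚ q) *ₚ r) i                          ≈⟨ coeff-* (p *ₚ q) r i ⟩
            conv (coeff (p *ₚ q)) (coeff r) i                ≈⟨ conv-cong (coeff-* p q) (λ _ → refl) i ⟩
            conv (conv (coeff p) (coeff q)) (coeff r) i      ≈⟨ conv-assoc (coeff p) (coeff q) (coeff r) i ⟩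
            conv (coeff p) (conv (coeff q) (coeff r)) i      ≈⟨ conv-cong {f = coeff p} (λ _ → refl) (coeff-* q r) i ⟨
            conv (coeff p) (coeff (q *ₚ r)) i                ≈⟨ coeff-* p (q *ₚ r) i ⟨
            coeff (p *ₚ (q *ₚ r)) i                          ∎
        ; *-identity = *-identityˡₚ , λ p → coeffwise λ i → trans (*-commₚ p oneₚ i) (at (*-identityˡₚ p) i)
        ; distrib = (λ p q r → coeffwise λ i → begin
              coeff (p *ₚ (q +ₚ r)) i                   ≈⟨ *-commₚ p (q +ₚ r) i ⟩
              coeff ((q +ₚ r) *ₚ p) i                   ≈⟨ *-distribʳₚ p q r i ⟩
              coeff (q *ₚ p) i + coeff (r *ₚ p) i       ≈⟨ +-cong (*-commₚ q p i) (*-commₚ r p i) ⟩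
              coeff (p *ₚ q) i + coeff (p *ₚ r) i       ≈⟨ coeff-+ (p *ₚ q) (p *ₚ r) i ⟨
              coeff (p *ₚ q +ₚ p *ₚ r) i                ∎)
          , (λ p q r → coeffwise λ i → trans (*-distribʳₚ p q r i) (sym (coeff-+ (q *ₚ p) (r *ₚ p) i)))
        }
      ; *-comm = λ p q → coeffwise (*-commₚ p q)
      }
    }
    where
    *-commₚ : ∀ p q i → coeff (p *ₚ q) i ≈ coeff (q *ₚ p) i
    *-commₚ p q i = trans (coeff-* p q i) (trans (conv-comm (coeff p) (coeff q) i) (sym (coeff-* q p i)))

    *-identityˡₚ : ∀ p → oneₚ *ₚ p ≋ p
    *-identityˡₚ p = coeffwise λ i → trans (coeff-+ (map (1# *_) p) _ i)
      (trans (+-cong (trans (coeff-scale 1# p i) (*-identityˡ _)) (coeff-0∷[] i)) (+-identityʳ _))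
      where
      coeff-0∷[] : ∀ i → coeff (0# ∷ []) i ≈ 0#
      coeff-0∷[] zero = refl
      coeff-0∷[] (suc i) = refl

    *-distribʳₚ : ∀ p q r i → coeff ((q +ₚ r) *ₚ p) i ≈ coeff (q *ₚ p) i + coeff (r *ₚ p) i
    *-distribʳₚ p q r i = begin
      coeff ((q +ₚ r) *ₚ p) i                          ≈⟨ coeff-* (q +ₚ r) p i ⟩
      conv (coeff (q +ₚ r)) (coeff p) i                ≈⟨ conv-cong (coeff-+ q r) (λ _ → refl) i ⟩
      conv (λ j → coeff q j + coeff r j) (coeff p) i   ≈⟨ conv-distribʳ (coeff q) (coeff r) (coeff p) i ⟩
      conv (coeff q) (coeff p) i + conv (coeff r) (coeff p) i ≈⟨ +-cong (coeff-* q p i) (coeff-* r p i) ⟨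
      coeff (q *ₚ p) i + coeff (r *ₚ p) i              ∎

-- The Euler derivation c d/dc.

module EulerDerivation {c ℓ} (R : CommutativeRing c ℓ) where
  open Poly R hiding (zero)
  open PolynomialRing R
  open IntegerSolver R
  module P = CommutativeRing polynomialRing
  module S = IntegerSolver polynomialRing

  const : Carrier → Pol
  const a = a ∷ []

  const-0 : const 0# ≋ []
  const-0 = coeffwise λ { zero → refl ; (suc i) → refl }

  const-* : ∀ a p → map (a *_) p ≋ const a *ₚ p
  const-* a p = coeffwise λ i → sym (trans (coeff-+ (map (a *_) p) _ i)
    (trans (+-congˡ (at const-0 i)) (+-identityʳ _)))

  -- Rewrites a list cell as a ring expression, so that list recursions can be handed to the ring
  -- solver.
  cons-split : ∀ a p → (a ∷ p) ≋ const a +ₚ Xₚ *ₚ p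
  cons-split a p = coeffwise λ i → sym (trans (coeff-+ (const a) (Xₚ *ₚ p) i) (helper i))
    where
    helper : ∀ i → coeff (const a) i + coeff (Xₚ *ₚ p) i ≈ coeff (a ∷ p) i
    helper zero = trans (+-congˡ (trans (coeff-* Xₚ p 0) (zeroˡ _))) (+-identityʳ a)
    helper (suc i) = trans (+-identityˡ _) (trans (coeff-* Xₚ p (suc i))
      (trans (+-cong (zeroˡ _) (trans (sym (coeff-* oneₚ p i)) (at (P.*-identityˡ p) i))) (+-identityˡ _)))

  -- The recursion is θ(a + c p) = c (p + θ p). Unlike d/dc, θ keeps degree bounds unchanged and has
  -- no constant term; both facts are used for root sums.
  θ : Pol → Pol
  θ [] = []
  θ (a ∷ p) = 0# ∷ (p +ₚ θ p)

  coeff-θ : ∀ p i → coeff (θ p) i ≈ natCast i * coeff p i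
  coeff-θ [] i = sym (zeroʳ _)
  coeff-θ (a ∷ p) zero = sym (zeroˡ a)
  coeff-θ (a ∷ p) (suc i) = trans (coeff-+ p (θ p) i) (trans (+-congˡ (coeff-θ p i))
    (solve 2 (λ x n → x :+ n :* x := (:1 :+ n) :* x) refl _ _))

  θ-cong : ∀ {p q} → p ≋ q → θ p ≋ θ q
  θ-cong {p} {q} e = coeffwise λ i →
    trans (coeff-θ p i) (trans (*-congˡ (at e i)) (sym (coeff-θ q i)))

  θ-+ : ∀ p q → θ (p +ₚ q) ≋ θ p +ₚ θ q
  θ-+ p q = coeffwise λ i → begin
    coeff (θ (p +ₚ q)) i                        ≈⟨ coeff-θ (p +ₚ q) i ⟩
    natCast i * coeff (p +ₚ q) i                ≈⟨ *-congˡ (coeff-+ p q i) ⟩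
    natCast i * (coeff p i + coeff q i)         ≈⟨ distribˡ _ _ _ ⟩
    natCast i * coeff p i + natCast i * coeff q i ≈⟨ +-cong (coeff-θ p i) (coeff-θ q i) ⟨
    coeff (θ p) i + coeff (θ q) i               ≈⟨ coeff-+ (θ p) (θ q) i ⟨
    coeff (θ p +ₚ θ q) i                        ∎
    where open import Relation.Binary.Reasoning.Setoid setoid

  -- The Leibniz rule for coefficients: the weight i of a term f j · g (i - j) splits as j + (i -
  -- j).
  conv-weight : ∀ f g i →
    natCast i * conv f g i ≈ conv (λ j → natCast j * f j) g i + conv f (λ j → natCast j * g j) i
  conv-weight f g zero =
    solve 2 (λ x y → :0 :* (x :* y) := :0 :* x :* y :+ x :* (:0 :* y)) refl _ _
  conv-weight f g (suc i) = begin
    n′ * (f 0 * g (suc i) + conv f′ g i)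
      ≈⟨ solve 4 (λ n x y z → (:1 :+ n) :* (x :* y :+ z) := :0 :* x :* y :+ z :+ (x :* ((:1 :+ n) :* y) :+ n :* z)) refl _ _ _ _ ⟩
    0# * f 0 * g (suc i) + conv f′ g i + (f 0 * (n′ * g (suc i)) + natCast i * conv f′ g i)
      ≈⟨ +-congˡ (+-congˡ (conv-weight f′ g i)) ⟩
    0# * f 0 * g (suc i) + conv f′ g i + (f 0 * (n′ * g (suc i)) + (conv (λ j → natCast j * f′ j) g i + conv f′ w i))
      ≈⟨ solve 5 (λ a b x y z → a :+ b :+ (x :+ (y :+ z)) := a :+ (b :+ y) :+ (x :+ z)) refl _ _ _ _ _ ⟩
    0# * f 0 * g (suc i) + (conv f′ g i + conv (λ j → natCast j * f′ j) g i) + (f 0 * (n′ * g (suc i)) + conv f′ w i)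
      ≈⟨ +-congʳ (+-congˡ (conv-distribʳ f′ _ g i)) ⟨
    0# * f 0 * g (suc i) + conv (λ j → f′ j + natCast j * f′ j) g i + (f 0 * (n′ * g (suc i)) + conv f′ w i)
      ≈⟨ +-congʳ (+-congˡ (conv-cong {g = g} (λ j → solve 2 (λ n x → x :+ n :* x := (:1 :+ n) :* x) refl (natCast j) (f′ j)) (λ _ → refl) i)) ⟩
    0# * f 0 * g (suc i) + conv (λ j → (1# + natCast j) * f′ j) g i + (f 0 * (n′ * g (suc i)) + conv f′ w i) ∎
    where
    open import Relation.Binary.Reasoning.Setoid setoid
    n′ = 1# + natCast i
    f′ w : ℕ → Carrier
    f′ j = f (suc j)
    w j = natCast j * g j

  θ-* : ∀ p q → θ (p *ₚ q) ≋ θ p *ₚ q +ₚ p *ₚ θ q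
  θ-* p q = coeffwise λ i → begin
    coeff (θ (p *ₚ q)) i
      ≈⟨ trans (coeff-θ (p *ₚ q) i) (*-congˡ (coeff-* p q i)) ⟩
    natCast i * conv (coeff p) (coeff q) i
      ≈⟨ conv-weight (coeff p) (coeff q) i ⟩
    conv (λ j → natCast j * coeff p j) (coeff q) i + conv (coeff p) (λ j → natCast j * coeff q j) i
      ≈⟨ +-cong (conv-cong (coeff-θ p) (λ _ → refl) i) (conv-cong {f = coeff p} (λ _ → refl) (coeff-θ q) i) ⟨
    conv (coeff (θ p)) (coeff q) i + conv (coeff p) (coeff (θ q)) i
      ≈⟨ +-cong (coeff-* (θ p) q i) (coeff-* p (θ q) i) ⟨
    coeff (θ p *ₚ q) i + coeff (p *ₚ θ q) i
      ≈⟨ coeff-+ (θ p *ₚ q) (p *ₚ θ q) i ⟨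
    coeff (θ p *ₚ q +ₚ p *ₚ θ q) i ∎
    where open import Relation.Binary.Reasoning.Setoid setoid

-- Division by monic polynomials and constant terms at infinity.

module MonicDivision {c ℓ} (R : CommutativeRing c ℓ) where
  open Poly R hiding (zero)
  open PolynomialRing R
  open EulerDerivation R
  open IntegerSolver R using (solve; _:=_; _:+_; _:*_; :-_; :0; :1)

  -- Equality in `R` is not assumed decidable, so degrees are bounded rather than computed. The
  -- bound is strict: n = 0 forces the zero polynomial.
  record DegBelow (n : ℕ) (p : Pol) : Set ℓ where
    constructor degBelow
    field vanish : ∀ i → n ≤ i → coeff p i ≈ 0#
  open DegBelow public

  below-resp : ∀ {n p q} → p ≋ q → DegBelow n p → DegBelow n q
  below-resp e d = degBelow λ i n≤i → trans (sym (at e i)) (vanish d i n≤i)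

  below-mono : ∀ {m n p} → m ≤ n → DegBelow m p → DegBelow n p
  below-mono m≤n d = degBelow λ i n≤i → vanish d i (ℕₚ.≤-trans m≤n n≤i)

  below-≡ : ∀ {m n p} → m ≡ n → DegBelow m p → DegBelow n p
  below-≡ ≡.refl d = d

  below-[] : ∀ {n} → DegBelow n []
  below-[] = degBelow λ _ _ → refl

  below-const : ∀ a → DegBelow 1 (const a)
  below-const a = degBelow λ { (suc i) _ → refl }

  below-X : DegBelow 2 Xₚ
  below-X = degBelow λ { (suc (suc i)) _ → refl ; (suc zero) (s≤s ()) }

  below-∷ : ∀ {n a p} → DegBelow n p → DegBelow (suc n) (a ∷ p)
  below-∷ d = degBelow λ { (suc i) (s≤s n≤i) → vanish d i n≤i }

  below-length : ∀ p → DegBelow (length p) p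
  below-length [] = below-[]
  below-length (a ∷ p) = below-∷ (below-length p)

  below-+ : ∀ {n p q} → DegBelow n p → DegBelow n q → DegBelow n (p +ₚ q)
  below-+ {p = p} {q} d e = degBelow λ i n≤i →
    trans (coeff-+ p q i) (trans (+-cong (vanish d i n≤i) (vanish e i n≤i)) (+-identityˡ 0#))

  below-neg : ∀ {n p} → DegBelow n p → DegBelow n (-ₚ p)
  below-neg {p = p} d = degBelow λ i n≤i →
    trans (coeff-neg p i) (trans (-‿cong (vanish d i n≤i)) (RingProperties.-0#≈0# ring))

  below-θ : ∀ {n p} → DegBelow n p → DegBelow n (θ p)
  below-θ {p = p} d = degBelow λ i n≤i →
    trans (coeff-θ p i) (trans (*-congˡ (vanish d i n≤i)) (zeroʳ _))

  conv-above : ∀ {f g} a b → (∀ i → suc a ≤ i → f i ≈ 0#) → (∀ i → b ≤ i → g i ≈ 0#) →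
    ∀ i → a ℕ.+ b ≤ i → conv f g i ≈ 0#
  conv-above zero b f≈0 g≈0 zero le = trans (*-congˡ (g≈0 0 le)) (zeroʳ _)
  conv-above {g = g} zero b f≈0 g≈0 (suc i) le =
    trans (+-cong (trans (*-congˡ (g≈0 (suc i) le)) (zeroʳ _)) (conv-zeroˡ g (λ j → f≈0 (suc j) (s≤s z≤n)) i)) (+-identityˡ 0#)
  conv-above (suc a) b f≈0 g≈0 (suc i) (s≤s le) =
    trans (+-cong (trans (*-congˡ (g≈0 (suc i) (ℕₚ.m≤n⇒m≤1+n (ℕₚ.≤-trans (ℕₚ.m≤n+m b a) le)))) (zeroʳ _))
      (conv-above a b (λ j a<j → f≈0 (suc j) (s≤s a<j)) g≈0 i le)) (+-identityˡ 0#)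

  conv-top : ∀ {f g} a b → (∀ i → suc a ≤ i → f i ≈ 0#) → (∀ i → suc b ≤ i → g i ≈ 0#) →
    conv f g (a ℕ.+ b) ≈ f a * g b
  conv-top zero zero f≈0 g≈0 = refl
  conv-top {g = g} zero (suc b) f≈0 g≈0 =
    trans (+-congˡ (conv-zeroˡ g (λ j → f≈0 (suc j) (s≤s z≤n)) b)) (+-identityʳ _)
  conv-top (suc a) b f≈0 g≈0 =
    trans (+-cong (trans (*-congˡ (g≈0 (suc (a ℕ.+ b)) (s≤s (ℕₚ.m≤n+m b a)))) (zeroʳ _))
      (conv-top a b (λ j a<j → f≈0 (suc j) (s≤s a<j)) g≈0)) (+-identityˡ _)

  -- One bound is weak (degree at most a), the other strict (degree below b). This asymmetric form
  -- fits a remainder, whose bound b may be 0.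
  below-* : ∀ {a b p q} → DegBelow (suc a) p → DegBelow b q → DegBelow (a ℕ.+ b) (p *ₚ q)
  below-* {a} {b} {p} {q} d e = degBelow λ i le →
    trans (coeff-* p q i) (conv-above a b (vanish d) (vanish e) i le)

  below-*-suc : ∀ {a b p q} → DegBelow (suc a) p → DegBelow (suc b) q → DegBelow (suc (a ℕ.+ b)) (p *ₚ q)
  below-*-suc {a} {b} d e = below-≡ (ℕₚ.+-suc a b) (below-* d e)

  coeff-*-top : ∀ {a b p q} → DegBelow (suc a) p → DegBelow (suc b) q →
    coeff (p *ₚ q) (a ℕ.+ b) ≈ coeff p a * coeff q b
  coeff-*-top {a} {b} {p} {q} d e = trans (coeff-* p q (a ℕ.+ b)) (conv-top a b (vanish d) (vanish e))

  record Monic : Set (c ⊔ ℓ) where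
    constructor monic
    field
      pol     : Pol
      degree  : ℕ
      bound   : DegBelow (suc degree) pol
      leading : coeff pol degree ≈ 1#
  open Monic public

  _·_ : Monic → Monic → Monic
  B · C = monic (pol B *ₚ pol C) (degree B ℕ.+ degree C) (below-*-suc (bound B) (bound C))
    (trans (coeff-*-top (bound B) (bound C)) (trans (*-cong (leading B) (leading C)) (*-identityˡ 1#)))

  infixl 7 _·_

  monic-+ : (B : Monic) (q : Pol) → DegBelow (degree B) q → Monic
  monic-+ B q d = monic (pol B +ₚ q) (degree B) (below-+ (bound B) (below-mono (ℕₚ.n≤1+n _) d))
    (trans (coeff-+ (pol B) q _) (trans (+-cong (leading B) (vanish d _ ℕₚ.≤-refl)) (+-identityʳ 1#)))

  monic-1 : Monic
  monic-1 = monic oneₚ 0 (below-const 1#) refl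

  -- If Q has degree at most n, its coefficient at n is the coefficient of Q B at n + deg B, which
  -- vanishes; so the bound on Q drops to 0 step by step.
  multiple-small⇒0 : (B : Monic) (Q : Pol) → DegBelow (degree B) (Q *ₚ pol B) → Q ≋ []
  multiple-small⇒0 B Q small = go (length Q) (below-length Q)
    where
    go : ∀ n → DegBelow n Q → Q ≋ []
    go zero d = coeffwise λ i → vanish d i z≤n
    go (suc n) d = go n (degBelow below)
      where
      coeff-n : coeff Q n ≈ 0#
      coeff-n = trans (sym (*-identityʳ _)) (trans (*-congˡ (sym (leading B)))
        (trans (sym (coeff-*-top d (bound B))) (vanish small _ (ℕₚ.m≤n+m _ n))))
      below : ∀ i → n ≤ i → coeff Q i ≈ 0#
      below i n≤i with ℕₚ.m≤n⇒m<n∨m≡n n≤i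
      ... | inj₁ n<i = vanish d i n<i
      ... | inj₂ ≡.refl = coeff-n

  record Division (B : Monic) (F : Pol) : Set (c ⊔ ℓ) where
    field
      quot rem : Pol
      split    : F ≋ quot *ₚ pol B +ₚ rem
      small    : DegBelow (degree B) rem

  -- Horner-style division: for a + c F first divide F. The new remainder candidate a + c · rem has
  -- degree at most deg B, so subtracting one constant multiple of B suffices.
  divide : (B : Monic) (F : Pol) → Division B F
  divide B [] = record { quot = [] ; rem = [] ; split = P.refl ; small = below-[] }
  divide B (a ∷ F) = record
    { quot = t ∷ quot
    ; rem = r +ₚ -ₚ (const t *ₚ pol B)
    ; split = begin
        a ∷ F                                                ≈⟨ cons-split a F ⟩
        const a +ₚ Xₚ *ₚ F                                   ≈⟨ P.+-congˡ {const a} (P.*-congˡ {Xₚ} split) ⟩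
        const a +ₚ Xₚ *ₚ (quot *ₚ pol B +ₚ rem)              ≈⟨ S.solve 6 (λ a x q b e t →
            a S.:+ x S.:* (q S.:* b S.:+ e) S.:= (t S.:+ x S.:* q) S.:* b S.:+ ((a S.:+ x S.:* e) S.:+ S.:- (t S.:* b)))
              P.refl (const a) Xₚ quot (pol B) rem (const t) ⟩
        (const t +ₚ Xₚ *ₚ quot) *ₚ pol B +ₚ ((const a +ₚ Xₚ *ₚ rem) +ₚ -ₚ (const t *ₚ pol B))
          ≈⟨ P.+-cong (P.*-congʳ (cons-split t quot)) (P.+-congʳ (cons-split a rem)) ⟨
        (t ∷ quot) *ₚ pol B +ₚ (r +ₚ -ₚ (const t *ₚ pol B))  ∎
    ; small = degBelow vanish′
    }
    where
    open import Relation.Binary.Reasoning.Setoid P.setoid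
    open Division (divide B F)
    r = a ∷ rem
    t = coeff r (degree B)
    tB : ∀ i → coeff (const t *ₚ pol B) i ≈ t * coeff (pol B) i
    tB i = trans (sym (at (const-* t (pol B)) i)) (coeff-scale t (pol B) i)
    coeff-rem : ∀ i → coeff (r +ₚ -ₚ (const t *ₚ pol B)) i ≈ coeff r i + - (t * coeff (pol B) i)
    coeff-rem i = trans (coeff-+ r (-ₚ (const t *ₚ pol B)) i) (+-congˡ (trans (coeff-neg (const t *ₚ pol B) i) (-‿cong (tB i))))
    vanish′ : ∀ i → degree B ≤ i → coeff (r +ₚ -ₚ (const t *ₚ pol B)) i ≈ 0#
    vanish′ i b≤i with ℕₚ.m≤n⇒m<n∨m≡n b≤i
    ... | inj₁ b<i = trans (coeff-rem i) (trans
            (+-cong (vanish (below-∷ {a = a} small) i b<i) (-‿cong (*-congˡ (vanish (bound B) i b<i))))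
            (solve 1 (λ t → :0 :+ :- (t :* :0) := :0) refl t))
    ... | inj₂ ≡.refl = trans (coeff-rem i) (trans
            (+-congˡ (-‿cong (*-congˡ (leading B))))
            (solve 1 (λ t → t :+ :- (t :* :1) := :0) refl t))

  -- The constant term of the polynomial part of the fraction F / B.

  opaque
    ct : Monic → Pol → Carrier
    ct B F = coeff (Division.quot (divide B F)) 0

    -- The difference of two divisions is a multiple of B of degree below deg B, hence zero. Each
    -- rule for `ct` therefore only has to exhibit a quotient and a small remainder.
    ct-unique : ∀ B {F} Q e → F ≋ Q *ₚ pol B +ₚ e → DegBelow (degree B) e → ct B F ≈ coeff Q 0
    ct-unique B {F} Q e split′ small′ = begin
      coeff quot 0                       ≈⟨ solve 2 (λ x y → x := y :+ (x :+ :- y)) refl _ _ ⟩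
      coeff Q 0 + (coeff quot 0 + - coeff Q 0) ≈⟨ +-congˡ (trans (coeff-+ quot (-ₚ Q) 0) (+-congˡ (coeff-neg Q 0))) ⟨
      coeff Q 0 + coeff (quot +ₚ -ₚ Q) 0 ≈⟨ +-congˡ (at (multiple-small⇒0 B (quot +ₚ -ₚ Q) (below-resp difference (below-+ small′ (below-neg small)))) 0) ⟩
      coeff Q 0 + 0#                     ≈⟨ +-identityʳ _ ⟩
      coeff Q 0                          ∎
      where
      open import Relation.Binary.Reasoning.Setoid setoid
      open Division (divide B F)
      difference : e +ₚ -ₚ rem ≋ (quot +ₚ -ₚ Q) *ₚ pol B
      difference = PR.begin
        e +ₚ -ₚ rem
          PR.≈⟨ S.solve 4 (λ q′ b e r → e S.:+ S.:- r S.:= (q′ S.:* b S.:+ e) S.:+ S.:- (q′ S.:* b S.:+ r)) P.refl Q (pol B) e rem ⟩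
        (Q *ₚ pol B +ₚ e) +ₚ -ₚ (Q *ₚ pol B +ₚ rem)
          PR.≈⟨ P.+-congʳ (P.trans (P.sym split′) split) ⟩
        (quot *ₚ pol B +ₚ rem) +ₚ -ₚ (Q *ₚ pol B +ₚ rem)
          PR.≈⟨ S.solve 4 (λ q q′ b r → (q S.:* b S.:+ r) S.:+ S.:- (q′ S.:* b S.:+ r) S.:= (q S.:+ S.:- q′) S.:* b) P.refl quot Q (pol B) rem ⟩
        (quot +ₚ -ₚ Q) *ₚ pol B PR.∎
        where import Relation.Binary.Reasoning.Setoid P.setoid as PR

    ct-cong : ∀ B {F G} → F ≋ G → ct B F ≈ ct B G
    ct-cong B {F} {G} F≋G = ct-unique B quot rem (P.trans F≋G split) small
      where open Division (divide B G)

    ct-+ : ∀ B F G → ct B (F +ₚ G) ≈ ct B F + ct B G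
    ct-+ B F G = trans
      (ct-unique B (F.quot +ₚ G.quot) (F.rem +ₚ G.rem)
        (P.trans (P.+-cong F.split G.split)
          (S.solve 5 (λ q q′ b r r′ → (q S.:* b S.:+ r) S.:+ (q′ S.:* b S.:+ r′) S.:= (q S.:+ q′) S.:* b S.:+ (r S.:+ r′))
            P.refl F.quot G.quot (pol B) F.rem G.rem))
        (below-+ F.small G.small))
      (coeff-+ F.quot G.quot 0)
      where
      module F = Division (divide B F)
      module G = Division (divide B G)

    ct-const : ∀ B a F → ct B (const a *ₚ F) ≈ a * ct B F
    ct-const B a F = trans
      (ct-unique B (const a *ₚ quot) (const a *ₚ rem)
        (P.trans (P.*-congˡ {const a} split)
          (S.solve 4 (λ a q b r → a S.:* (q S.:* b S.:+ r) S.:= a S.:* q S.:* b S.:+ a S.:* r) P.refl (const a) quot (pol B) rem))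
        (below-* (below-const a) small))
      (trans (coeff-* (const a) quot 0) refl)
      where open Division (divide B F)

    ct-neg : ∀ B F → ct B (-ₚ F) ≈ - ct B F
    ct-neg B F = trans
      (ct-unique B (-ₚ quot) (-ₚ rem)
        (P.trans (P.-‿cong split)
          (S.solve 3 (λ q b r → S.:- (q S.:* b S.:+ r) S.:= S.:- q S.:* b S.:+ S.:- r) P.refl quot (pol B) rem))
        (below-neg small))
      (coeff-neg quot 0)
      where open Division (divide B F)

    ct-small : ∀ B {F} → DegBelow (degree B) F → ct B F ≈ 0#
    ct-small B {F} = ct-unique B [] F P.refl

    ct-multiple : ∀ B Q → ct B (Q *ₚ pol B) ≈ coeff Q 0
    ct-multiple B Q = ct-unique B Q [] (P.sym (P.+-identityʳ _)) below-[]

    -- Expanding a fraction by C keeps the quotient and multiplies the remainder by C; used to reach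
    -- common denominators.
    ct-cancel : ∀ B C F → ct (B · C) (F *ₚ pol C) ≈ ct B F
    ct-cancel B C F = ct-unique (B · C) quot (rem *ₚ pol C)
      (P.trans (P.*-congʳ split)
        (S.solve 4 (λ q b r c → (q S.:* b S.:+ r) S.:* c S.:= q S.:* (b S.:* c) S.:+ r S.:* c) P.refl quot (pol B) rem (pol C)))
      (below-≡ (ℕₚ.+-comm (degree C) (degree B)) (below-resp (P.*-comm (pol C) rem) (below-* (bound C) small)))
      where open Division (divide B F)

    ct-cancelˡ : ∀ B C F → ct (B · C) (F *ₚ pol B) ≈ ct C F
    ct-cancelˡ B C F = ct-unique (B · C) quot (rem *ₚ pol B)
      (P.trans (P.*-congʳ split)
        (S.solve 4 (λ q b r c → (q S.:* c S.:+ r) S.:* b S.:= q S.:* (b S.:* c) S.:+ r S.:* b) P.refl quot (pol B) rem (pol C)))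
      (below-resp (P.*-comm (pol B) rem) (below-* (bound B) small))
      where open Division (divide C F)

  -- The degree is data stored in `Monic`; in the zero ring equal polynomials could carry different
  -- degrees.
  monic-degree-unique : ¬ 1# ≈ 0# → ∀ B C → pol B ≋ pol C → degree B ≡ degree C
  monic-degree-unique 1≉0 B C e with ℕₚ.<-cmp (degree B) (degree C)
  ... | tri< b<c _ _ = ⊥-elim (1≉0 (trans (sym (leading C)) (trans (sym (at e _)) (vanish (bound B) _ b<c))))
  ... | tri≈ _ b≡c _ = b≡c
  ... | tri> _ _ c<b = ⊥-elim (1≉0 (trans (sym (leading B)) (trans (at e _) (vanish (bound C) _ c<b))))

  opaque
    unfolding ct

    ct-resp : ¬ 1# ≈ 0# → ∀ B C F → pol B ≋ pol C → ct B F ≈ ct C F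
    ct-resp 1≉0 B C F e = ct-unique B quot rem
      (P.trans split (P.+-congʳ {rem} (P.*-congˡ {quot} (P.sym e))))
      (below-≡ (≡.sym (monic-degree-unique 1≉0 B C e)) small)
      where open Division (divide C F)

-- Sums over the roots of a monic polynomial, without splitting it.

module RootSums {c ℓ} (R : CommutativeRing c ℓ) where
  open Poly R hiding (zero)
  open PolynomialRing R
  open EulerDerivation R
  open MonicDivision R
  open IntegerSolver R using (solve; _:=_; _:+_; _:*_; :0; :1)

  -- If B = ∏ (c − βⱼ), then g θB / B has constant term Σ g(βⱼ) at infinity.

  opaque
    rootSum : Monic → Pol → Carrier
    rootSum B g = ct B (g *ₚ θ (pol B))

    rootSum-cong : ∀ B {g h} → g ≋ h → rootSum B g ≈ rootSum B h
    rootSum-cong B g≋h = ct-cong B (P.*-congʳ g≋h)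

    rootSum-+ : ∀ B g h → rootSum B (g +ₚ h) ≈ rootSum B g + rootSum B h
    rootSum-+ B g h = trans (ct-cong B (P.distribʳ (θ (pol B)) g h)) (ct-+ B _ _)

    rootSum-neg : ∀ B g → rootSum B (-ₚ g) ≈ - rootSum B g
    rootSum-neg B g = trans (ct-cong B (S.solve 2 (λ g h → S.:- g S.:* h S.:= S.:- (g S.:* h)) P.refl g (θ (pol B))))
      (ct-neg B (g *ₚ θ (pol B)))

    rootSum-const : ∀ B a g → rootSum B (const a *ₚ g) ≈ a * rootSum B g
    rootSum-const B a g = trans (ct-cong B (P.*-assoc (const a) g (θ (pol B)))) (ct-const B a (g *ₚ θ (pol B)))

    coeff-*θ-0 : ∀ q p → coeff (q *ₚ θ p) 0 ≈ 0#
    coeff-*θ-0 q p = trans (coeff-* q (θ p) 0) (trans (*-congˡ (trans (coeff-θ p 0) (zeroˡ _))) (zeroʳ _))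

    -- The fraction q B θB / B is the polynomial q θB, whose constant term is 0 because θB has none.
    rootSum-multiple : ∀ B q → rootSum B (q *ₚ pol B) ≈ 0#
    rootSum-multiple B q = trans
      (ct-cong B (S.solve 3 (λ q b t → q S.:* b S.:* t S.:= q S.:* t S.:* b) P.refl q (pol B) (θ (pol B))))
      (trans (ct-multiple B (q *ₚ θ (pol B))) (coeff-*θ-0 q (pol B)))

    rootSum-mod : ∀ B {g h} q → g ≋ h +ₚ q *ₚ pol B → rootSum B g ≈ rootSum B h
    rootSum-mod B {g} {h} q e = trans (rootSum-cong B e) (trans (rootSum-+ B h _)
      (trans (+-congˡ (rootSum-multiple B q)) (+-identityʳ _)))

    -- The logarithmic derivative is additive: θ(BC) / (BC) = θB / B + θC / C.
    rootSum-· : ∀ B C g → rootSum (B · C) g ≈ rootSum B g + rootSum C g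
    rootSum-· B C g = trans
      (ct-cong (B · C) (P.trans (P.*-congˡ {g} (θ-* (pol B) (pol C)))
        (S.solve 5 (λ g b c b′ c′ → g S.:* (b′ S.:* c S.:+ b S.:* c′) S.:= (g S.:* b′) S.:* c S.:+ (g S.:* c′) S.:* b)
          P.refl g (pol B) (pol C) (θ (pol B)) (θ (pol C)))))
      (trans (ct-+ (B · C) (g *ₚ θ (pol B) *ₚ pol C) (g *ₚ θ (pol C) *ₚ pol B))
        (+-cong (ct-cancel B C (g *ₚ θ (pol B))) (ct-cancelˡ B C (g *ₚ θ (pol C)))))

    rootSum-1 : ∀ g → rootSum monic-1 g ≈ 0#
    rootSum-1 g = trans (rootSum-cong monic-1 (P.sym (P.*-identityʳ g))) (rootSum-multiple monic-1 g)

    rootSum-resp : ¬ 1# ≈ 0# → ∀ B C g → pol B ≋ pol C → rootSum B g ≈ rootSum C g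
    rootSum-resp 1≉0 B C g e = trans (ct-cong B (P.*-congˡ {g} (θ-cong e))) (ct-resp 1≉0 B C _ e)

  prodᴹ : List Monic → Monic
  prodᴹ = foldr _·_ monic-1

  sumBy : ∀ {a} {A : Set a} → (A → Carrier) → List A → Carrier
  sumBy f = foldr (λ x s → f x + s) 0#

  rootSum-prod : ∀ {a} {A : Set a} (F : A → Monic) xs g →
    rootSum (prodᴹ (map F xs)) g ≈ sumBy (λ x → rootSum (F x) g) xs
  rootSum-prod F [] g = rootSum-1 g
  rootSum-prod F (x ∷ xs) g = trans (rootSum-· (F x) _ g) (+-congˡ (rootSum-prod F xs g))

  eval : Pol → Carrier → Carrier
  eval [] x = 0#
  eval (a ∷ p) x = a + x * eval p x

  eval-+ : ∀ p q x → eval (p +ₚ q) x ≈ eval p x + eval q x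
  eval-+ [] q x = sym (+-identityˡ _)
  eval-+ (a ∷ p) [] x = sym (+-identityʳ _)
  eval-+ (a ∷ p) (b ∷ q) x = trans (+-congˡ (*-congˡ (eval-+ p q x)))
    (solve 5 (λ a b x u v → a :+ b :+ x :* (u :+ v) := a :+ x :* u :+ (b :+ x :* v)) refl a b x _ _)

  eval-scale : ∀ a p x → eval (map (a *_) p) x ≈ a * eval p x
  eval-scale a [] x = sym (zeroʳ a)
  eval-scale a (b ∷ p) x = trans (+-congˡ (*-congˡ (eval-scale a p x)))
    (solve 4 (λ a b x u → a :* b :+ x :* (a :* u) := a :* (b :+ x :* u)) refl a b x _)

  eval-* : ∀ p q x → eval (p *ₚ q) x ≈ eval p x * eval q x
  eval-* [] q x = sym (zeroˡ _)
  eval-* (a ∷ p) q x = trans (eval-+ (map (a *_) q) _ x)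
    (trans (+-cong (eval-scale a q x) (+-congˡ (*-congˡ (eval-* p q x))))
      (solve 4 (λ a x u v → a :* v :+ (:0 :+ x :* (u :* v)) := (a :+ x :* u) :* v) refl a x _ _))

  eval-1 : ∀ x → eval oneₚ x ≈ 1#
  eval-1 x = solve 1 (λ x → :1 :+ x :* :0 := :1) refl x

  eval-prod : ∀ {a} {A : Set a} {f : A → Pol} {h : A → Carrier} {x} → (∀ y → eval (f y) x ≈ h y) →
    ∀ ys → eval (prodₚ (map f ys)) x ≈ foldr _*_ 1# (map h ys)
  eval-prod {x = x} e [] = eval-1 x
  eval-prod {f = f} {x = x} e (y ∷ ys) = trans (eval-* (f y) _ x) (*-cong (e y) (eval-prod e ys))

  eval-a : ∀ i x → eval (aₚ i) x ≈ aEval i x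
  eval-a zero x = refl
  eval-a (suc i) x = trans (eval-+ (aₚ i *ₚ aₚ i) Xₚ x)
    (+-cong (trans (eval-* (aₚ i) (aₚ i) x) (*-cong (eval-a i x) (eval-a i x)))
      (solve 1 (λ x → :0 :+ x :* (:1 :+ x :* :0) := x) refl x))

  open Exp P.commutativeSemiring public renaming (_^_ to _^ₚ_)

  pow-cong : ∀ {x y} n → x ≈ y → pow x n ≈ pow y n
  pow-cong zero e = refl
  pow-cong (suc n) e = *-cong e (pow-cong n e)

  eval-^ : ∀ p n x → eval (p ^ₚ n) x ≈ pow (eval p x) n
  eval-^ p zero x = eval-1 x
  eval-^ p (suc n) x = trans (eval-* p (p ^ₚ n) x) (*-congˡ (eval-^ p n x))

  linear : Carrier → Monic
  linear α = monic (X- α) 1 (below-∷ (below-const 1#)) refl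

  -- Synthetic division by c - α: the Horner values of g at α are the coefficients of the quotient.
  remainder : ∀ g α → Division (linear α) g
  remainder g α = record { quot = proj₁ (go g) ; rem = const (eval g α) ; split = proj₂ (go g) ; small = below-const _ }
    where
    open import Relation.Binary.Reasoning.Setoid P.setoid
    linear-split : X- α ≋ -ₚ const α +ₚ Xₚ *ₚ oneₚ
    linear-split = cons-split (- α) oneₚ
    go : ∀ g → ∃ λ q → g ≋ q *ₚ (X- α) +ₚ const (eval g α)
    go [] = [] , P.sym const-0
    go (a ∷ g) = eval g α ∷ q , (begin
      a ∷ g                                          ≈⟨ cons-split a g ⟩
      const a +ₚ Xₚ *ₚ g                             ≈⟨ P.+-congˡ {const a} (P.*-congˡ {Xₚ} split) ⟩
      const a +ₚ Xₚ *ₚ (q *ₚ (X- α) +ₚ const v)      ≈⟨ P.+-congˡ {const a} (P.*-congˡ {Xₚ} (P.+-congʳ {const v} (P.*-congˡ {q} linear-split))) ⟩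
      const a +ₚ Xₚ *ₚ (q *ₚ (-ₚ const α +ₚ Xₚ *ₚ oneₚ) +ₚ const v)
        ≈⟨ S.solve 5 (λ a α x q v → a S.:+ x S.:* (q S.:* (S.:- α S.:+ x S.:* S.:1) S.:+ v)
             S.:= (v S.:+ x S.:* q) S.:* (S.:- α S.:+ x S.:* S.:1) S.:+ (a S.:+ α S.:* v)) P.refl (const a) (const α) Xₚ q (const v) ⟩
      (const v +ₚ Xₚ *ₚ q) *ₚ (-ₚ const α +ₚ Xₚ *ₚ oneₚ) +ₚ (const a +ₚ const α *ₚ const v)
        ≈⟨ P.+-cong (P.*-cong (cons-split v q) linear-split) const-eval ⟨
      (v ∷ q) *ₚ (X- α) +ₚ const (a + α * v)   ∎)
      where
      q = proj₁ (go g)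
      split = proj₂ (go g)
      const-eval : const (a + α * eval g α) ≋ const a +ₚ const α *ₚ const (eval g α)
      const-eval = coeffwise λ { zero → +-congˡ (sym (+-identityʳ _)) ; (suc i) → refl }
      v = eval g α

  opaque
    unfolding rootSum

    rootSum-linear : ∀ α g → rootSum (linear α) g ≈ eval g α
    rootSum-linear α g = trans
      (ct-cong (linear α) (P.*-congˡ {g} θ-linear))
      -- Multiply g = q (c - α) + v by c and write c = (c - α) + α in the last term: the quotient is
      -- c q + v and the remainder α v.
      (trans (ct-unique (linear α) (Xₚ *ₚ quot +ₚ rem) (const α *ₚ rem)
        (P.trans (P.*-congʳ {Xₚ} split)
          (P.trans (S.solve 4 (λ q b r x → (q S.:* b S.:+ r) S.:* x S.:= x S.:* q S.:* b S.:+ r S.:* x) P.refl quot (X- α) rem Xₚ)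
          (P.trans (P.+-congˡ {Xₚ *ₚ quot *ₚ (X- α)} (P.*-congˡ {rem} X-split))
            (S.solve 5 (λ q b r x a → x S.:* q S.:* b S.:+ r S.:* (b S.:+ a) S.:= (x S.:* q S.:+ r) S.:* b S.:+ a S.:* r)
              P.refl quot (X- α) rem Xₚ (const α)))))
        (below-* (below-const α) small))
      (trans (coeff-+ (Xₚ *ₚ quot) rem 0) (trans (+-congʳ (trans (coeff-* Xₚ quot 0) (zeroˡ _))) (+-identityˡ _))))
      where
      open Division (remainder g α)
      X-split : Xₚ ≋ (X- α) +ₚ const α
      X-split = coeffwise λ { zero → sym (-‿inverseˡ α) ; (suc zero) → refl ; (suc (suc i)) → refl }
      θ-linear : θ (X- α) ≋ Xₚ
      θ-linear = coeffwise λ { zero → refl ; (suc zero) → +-identityʳ 1# ; (suc (suc i)) → refl }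

  roots : List Carrier → Monic
  roots αs = prodᴹ (map linear αs)

  pol-roots : ∀ αs → pol (roots αs) ≡ prodₚ (map X-_ αs)
  pol-roots [] = ≡.refl
  pol-roots (α ∷ αs) = ≡.cong ((X- α) *ₚ_) (pol-roots αs)

  rootSum-roots : ∀ αs g → rootSum (roots αs) g ≈ sumBy (eval g) αs
  rootSum-roots [] g = rootSum-1 g
  rootSum-roots (α ∷ αs) g = trans (rootSum-· (linear α) (roots αs) g)
    (+-cong (rootSum-linear α g) (rootSum-roots αs g))

-- Root sums of low degree along the critical orbit.

module CriticalOrbit {c ℓ} (R : CommutativeRing c ℓ) where
  open Poly R hiding (zero)
  open PolynomialRing R
  open EulerDerivation R
  open MonicDivision R
  open RootSums R

  -- F / B - G / C = E / (BC), and a fraction of negative degree has no constant term at infinity.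
  ct-close : ∀ B C F G E → F *ₚ pol C ≋ G *ₚ pol B +ₚ E → DegBelow (degree B ℕ.+ degree C) E → ct B F ≈ ct C G
  ct-close B C F G E e small = begin
    ct B F                                     ≈⟨ ct-cancel B C F ⟨
    ct (B · C) (F *ₚ pol C)                    ≈⟨ ct-cong (B · C) e ⟩
    ct (B · C) (G *ₚ pol B +ₚ E)               ≈⟨ ct-+ (B · C) (G *ₚ pol B) E ⟩
    ct (B · C) (G *ₚ pol B) + ct (B · C) E     ≈⟨ +-cong (ct-cancelˡ B C G) (ct-small (B · C) small) ⟩
    ct C G + 0#                                ≈⟨ +-identityʳ _ ⟩
    ct C G                                     ∎
    where open import Relation.Binary.Reasoning.Setoid setoid

  -- The numerator of θp / p - θq / q over the common denominator p q.
  wronskian : Pol → Pol → Pol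
  wronskian p q = θ p *ₚ q +ₚ -ₚ (p *ₚ θ q)

  below-wronskian : ∀ {a b p q} → DegBelow (suc a) p → DegBelow (suc b) q → DegBelow (suc (a ℕ.+ b)) (wronskian p q)
  below-wronskian d e = below-+ (below-*-suc (below-θ d) e) (below-neg (below-*-suc d (below-θ e)))

  opaque
    unfolding rootSum

    rootSum-difference : ∀ B C g → rootSum B g ≈ rootSum C g + ct (B · C) (g *ₚ wronskian (pol B) (pol C))
    rootSum-difference B C g = begin
      ct B (g *ₚ θ (pol B))
        ≈⟨ ct-cancel B C _ ⟨
      ct (B · C) (g *ₚ θ (pol B) *ₚ pol C)
        ≈⟨ ct-cong (B · C) (S.solve 5 (λ g b c b′ c′ → g S.:* b′ S.:* c S.:=
             g S.:* c′ S.:* b S.:+ g S.:* (b′ S.:* c S.:+ S.:- (b S.:* c′)))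
             P.refl g (pol B) (pol C) (θ (pol B)) (θ (pol C))) ⟩
      ct (B · C) (g *ₚ θ (pol C) *ₚ pol B +ₚ g *ₚ wronskian (pol B) (pol C))
        ≈⟨ ct-+ (B · C) _ _ ⟩
      ct (B · C) (g *ₚ θ (pol C) *ₚ pol B) + ct (B · C) (g *ₚ wronskian (pol B) (pol C))
        ≈⟨ +-congʳ (ct-cancelˡ B C _) ⟩
      rootSum C g + ct (B · C) (g *ₚ wronskian (pol B) (pol C)) ∎
      where open import Relation.Binary.Reasoning.Setoid setoid

  -- The Wronskian is bilinear and alternating, so that of C + q with C is that of q with C: only
  -- the perturbation counts in the error.
  rootSum-perturb : ∀ B C q g → pol B ≋ pol C +ₚ q →
    rootSum B g ≈ rootSum C g + ct (B · C) (g *ₚ wronskian q (pol C))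
  rootSum-perturb B C q g e = trans (rootSum-difference B C g) (+-congˡ (ct-cong (B · C) (P.*-congˡ {g} (begin
    θ (pol B) *ₚ pol C +ₚ -ₚ (pol B *ₚ θ (pol C))
      ≈⟨ P.+-cong (P.*-congʳ {pol C} (P.trans (θ-cong e) (θ-+ (pol C) q))) (P.-‿cong (P.*-congʳ {θ (pol C)} e)) ⟩
    (θ (pol C) +ₚ θ q) *ₚ pol C +ₚ -ₚ ((pol C +ₚ q) *ₚ θ (pol C))
      ≈⟨ S.solve 4 (λ c c′ q q′ → (c′ S.:+ q′) S.:* c S.:+ S.:- ((c S.:+ q) S.:* c′) S.:= q′ S.:* c S.:+ S.:- (q S.:* c′))
           P.refl (pol C) (θ (pol C)) q (θ q) ⟩
    wronskian q (pol C) ∎))))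
    where open import Relation.Binary.Reasoning.Setoid P.setoid

  -- The error fraction has numerator of degree at most t + s + deg C over a denominator of degree 2
  -- deg C, so it disappears at infinity.
  rootSum-stable : ∀ B C q g {s t} → pol B ≋ pol C +ₚ q → degree B ≡ degree C →
    DegBelow (suc t) g → DegBelow (suc s) q → t ℕ.+ s < degree C → rootSum B g ≈ rootSum C g
  rootSum-stable B C q g {s} {t} e eq dg dq lt = trans (rootSum-perturb B C q g e) (trans
    (+-congˡ (ct-small (B · C) (below-mono le (below-*-suc dg (below-wronskian dq (bound C))))))
    (+-identityʳ _))
    where
    open ℕₚ.≤-Reasoning
    le : suc (t ℕ.+ (s ℕ.+ degree C)) ≤ degree B ℕ.+ degree C
    le = begin
      suc (t ℕ.+ (s ℕ.+ degree C))  ≡⟨ ≡.cong suc (ℕₚ.+-assoc t s _) ⟨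
      suc (t ℕ.+ s) ℕ.+ degree C    ≤⟨ ℕₚ.+-monoˡ-≤ (degree C) lt ⟩
      degree C ℕ.+ degree C         ≡⟨ ≡.cong (ℕ._+ degree C) eq ⟨
      degree B ℕ.+ degree C         ∎

  -- Powers of 2, defined by doubling so that `D (suc i)` is by computation the degree of
  -- `A i · A i`.
  D : ℕ → ℕ
  D zero = 1
  D (suc i) = D i ℕ.+ D i

  D≥1 : ∀ i → 1 ≤ D i
  D≥1 zero = s≤s z≤n
  D≥1 (suc i) = ℕₚ.≤-trans (D≥1 i) (ℕₚ.m≤m+n _ _)

  D-mono : ∀ k q → D q ≤ D (k ℕ.+ q)
  D-mono zero q = ℕₚ.≤-refl
  D-mono (suc k) q = ℕₚ.≤-trans (D-mono k q) (ℕₚ.m≤m+n _ _)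

  D≡2^ : ∀ i → D i ≡ 2 ℕ.^ i
  D≡2^ zero = ≡.refl
  D≡2^ (suc i) = ≡.cong₂ ℕ._+_ (D≡2^ i) (≡.trans (D≡2^ i) (≡.sym (ℕₚ.+-identityʳ _)))

  -- The shift by one makes b i have degree 2 ^ i.

  opaque
    b : ℕ → Pol
    b i = aₚ (suc i)

    b≡a : ∀ i → b i ≡ aₚ (suc i)
    b≡a i = ≡.refl

    b-suc : ∀ i → b (suc i) ≋ b i *ₚ b i +ₚ Xₚ
    b-suc i = P.refl

    b-below : ∀ i → DegBelow (suc (D i)) (b i)
    b-leading : ∀ i → coeff (b i) (D i) ≈ 1#

    b-below zero = below-X
    b-below (suc i) = below-+ (below-*-suc (b-below i) (b-below i))
      (below-mono (s≤s (ℕₚ.+-mono-≤ (D≥1 i) z≤n)) below-X)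

    b-leading zero = refl
    b-leading (suc i) = leading (monic-+ (B · B) Xₚ (below-mono (ℕₚ.+-mono-≤ (D≥1 i) (D≥1 i)) below-X))
      where
      B : Monic
      B = monic (b i) (D i) (b-below i) (b-leading i)

  A : ℕ → Monic
  A i = monic (b i) (D i) (b-below i) (b-leading i)

  -- H q k = a_{m+k} + a_{m−1} for m = q + 2: the factor of G_{m,n} belonging to the divisor k + 1 of n.

  H : (q k : ℕ) → Monic
  H q k = monic-+ (A (suc k ℕ.+ q)) (b q) (below-mono lt (b-below q))
    where
    lt : suc (D q) ≤ D (suc k ℕ.+ q)
    lt = ℕₚ.+-mono-≤ (D≥1 (k ℕ.+ q)) (D-mono k q)

  double : Carrier → Carrier
  double x = x + x

  -- In `b (suc i)`, which is `b i` squared plus c, the term c is negligible against a g of such low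
  -- degree, and the square has every root of `b i` twice.
  rootSum-A-suc : ∀ i g {t} → DegBelow (suc t) g → t ℕ.+ 1 < D (suc i) →
    rootSum (A (suc i)) g ≈ double (rootSum (A i) g)
  rootSum-A-suc i g dg lt = trans
    (rootSum-stable (A (suc i)) (A i · A i) Xₚ g (b-suc i) ≡.refl dg below-X lt)
    (rootSum-· (A i) (A i) g)

  -- The first exponent belongs to the highest index.

  w : ℕ → List ℕ → Pol
  w q [] = oneₚ
  w q (x ∷ e) = b (length e ℕ.+ q) ^ₚ x *ₚ w q e

  monomial : (q d : ℕ) → List ℕ → Pol
  monomial q d e = Xₚ ^ₚ d *ₚ w q e

  -- Bit vectors encode the subsets S. `Ones` is the full set; `HasZero` is a proper subset,
  -- witnessed by its highest missing index.
  data Bits : List ℕ → Set where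
    []  : Bits []
    0∷_ : ∀ {e} → Bits e → Bits (0 ∷ e)
    1∷_ : ∀ {e} → Bits e → Bits (1 ∷ e)

  data Ones : List ℕ → Set where
    []  : Ones []
    1∷_ : ∀ {e} → Ones e → Ones (1 ∷ e)

  data HasZero : List ℕ → Set where
    0∷_ : ∀ {e} → Bits e → HasZero (0 ∷ e)
    1∷_ : ∀ {e} → HasZero e → HasZero (1 ∷ e)

  ones? : ∀ {e} → Bits e → Ones e ⊎ HasZero e
  ones? [] = inj₁ []
  ones? (0∷ bs) = inj₂ (0∷ bs)
  ones? (1∷ bs) with ones? bs
  ... | inj₁ os = inj₁ (1∷ os)
  ... | inj₂ hz = inj₂ (1∷ hz)

  -- gap q k = deg (b q ⋯ b (q + k − 1)).

  gap : ℕ → ℕ → ℕ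
  gap q zero = 0
  gap q (suc k) = D (k ℕ.+ q) ℕ.+ gap q k

  gap+D : ∀ q k → gap q k ℕ.+ D q ≡ D (k ℕ.+ q)
  gap+D q zero = ≡.refl
  gap+D q (suc k) = ≡.trans (ℕₚ.+-assoc (D (k ℕ.+ q)) _ _) (≡.cong (D (k ℕ.+ q) ℕ.+_) (gap+D q k))

  below-^ : ∀ {a p} n → DegBelow (suc a) p → DegBelow (suc (n ℕ.* a)) (p ^ₚ n)
  below-^ zero d = below-const 1#
  below-^ (suc n) d = below-*-suc d (below-^ n d)

  below-X^ : ∀ d → DegBelow (suc d) (Xₚ ^ₚ d)
  below-X^ d = below-≡ (≡.cong suc (ℕₚ.*-identityʳ d)) (below-^ d below-X)

  w-below : ∀ q {e} → Bits e → DegBelow (suc (gap q (length e))) (w q e)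
  w-below q [] = below-const 1#
  w-below q {0 ∷ e} (0∷ bs) = below-mono (s≤s (ℕₚ.m≤n+m _ (D (length e ℕ.+ q))))
    (below-*-suc (below-const 1#) (w-below q bs))
  w-below q (1∷ bs) = below-*-suc (below-resp (P.sym (P.*-identityʳ _)) (b-below _)) (w-below q bs)

  -- Every factor has degree at least `D q`, so leaving one out saves at least the degree of the
  -- term `b q` in `H`.
  w-below-hasZero : ∀ q {e} → HasZero e → ∃ λ r → r ℕ.+ D q ≤ gap q (length e) × DegBelow (suc r) (w q e)
  w-below-hasZero q {0 ∷ e} (0∷ bs) = gap q (length e) ,
    ℕₚ.≤-trans (ℕₚ.≤-reflexive (ℕₚ.+-comm (gap q (length e)) _)) (ℕₚ.+-monoˡ-≤ _ (D-mono (length e) q)) ,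
    below-*-suc (below-const 1#) (w-below q bs)
  w-below-hasZero q {1 ∷ e} (1∷ hz) with w-below-hasZero q hz
  ... | r , le , d = D (length e ℕ.+ q) ℕ.+ r ,
    ℕₚ.≤-trans (ℕₚ.≤-reflexive (ℕₚ.+-assoc (D (length e ℕ.+ q)) r _)) (ℕₚ.+-monoʳ-≤ (D (length e ℕ.+ q)) le) ,
    below-*-suc (below-resp (P.sym (P.*-identityʳ _)) (b-below _)) d

  monomial-below : ∀ q d {e} → Bits e → DegBelow (suc (d ℕ.+ gap q (length e))) (monomial q d e)
  monomial-below q d bs = below-*-suc (below-X^ d) (w-below q bs)

  -- The hypothesis on i is spent here: of the two spare units, one is the degree of the
  -- perturbation `Xₚ` and one makes the inequality strict.
  d+gap<D : ∀ q d k → d ℕ.+ 2 ≤ D q → (d ℕ.+ gap q k) ℕ.+ 1 < D (k ℕ.+ q)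
  d+gap<D q d k le = begin
    suc (d ℕ.+ gap q k ℕ.+ 1)   ≡⟨ rearrange d (gap q k) ⟩
    (d ℕ.+ 2) ℕ.+ gap q k       ≤⟨ ℕₚ.+-monoˡ-≤ (gap q k) le ⟩
    D q ℕ.+ gap q k             ≡⟨ ℕₚ.+-comm (D q) _ ⟩
    gap q k ℕ.+ D q             ≡⟨ gap+D q k ⟩
    D (k ℕ.+ q)                 ∎
    where
    open ℕₚ.≤-Reasoning
    rearrange : ∀ d g → suc (d ℕ.+ g ℕ.+ 1) ≡ (d ℕ.+ 2) ℕ.+ g
    rearrange = ℕSolver.solve-∀

  -- Each step down the orbit doubles the root sum, until the top factor of the monomial divides the modulus.

  rootSum-0∷ : ∀ q d {e} → d ℕ.+ 2 ≤ D q → Bits e →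
    rootSum (A (suc (length e) ℕ.+ q)) (monomial q d (0 ∷ e)) ≈ double (rootSum (A (length e ℕ.+ q)) (monomial q d e))
  rootSum-0∷ q d {e} le bs = trans
    (rootSum-A-suc (length e ℕ.+ q) _ (monomial-below q d (0∷ bs)) (d+gap<D q d (suc (length e)) le))
    (+-cong drop drop)
    where
    drop : rootSum (A (length e ℕ.+ q)) (monomial q d (0 ∷ e)) ≈ rootSum (A (length e ℕ.+ q)) (monomial q d e)
    drop = rootSum-cong _ (P.*-congˡ {Xₚ ^ₚ d} (P.*-identityˡ (w q e)))

  rootSum-1∷ : ∀ q d {e} → d ℕ.+ 2 ≤ D q → Bits e →
    rootSum (A (suc (length e) ℕ.+ q)) (monomial q d (1 ∷ e)) ≈ 0#
  rootSum-1∷ q d {e} le bs = trans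
    (rootSum-A-suc (length e ℕ.+ q) _ (monomial-below q d (1∷ bs)) (d+gap<D q d (suc (length e)) le))
    (trans (+-cong vanishes vanishes) (+-identityˡ 0#))
    where
    vanishes : rootSum (A (length e ℕ.+ q)) (monomial q d (1 ∷ e)) ≈ 0#
    vanishes = trans
      (rootSum-cong _ (S.solve 3 (λ x b v → x S.:* (b S.:* S.:1 S.:* v) S.:= x S.:* v S.:* b) P.refl (Xₚ ^ₚ d) (b (length e ℕ.+ q)) (w q e)))
      (rootSum-multiple (A (length e ℕ.+ q)) (Xₚ ^ₚ d *ₚ w q e))

  -- With q = m - 2 this compares m + 1 with m. Being a record, it lets the family f be recovered
  -- from the type.
  record Doubles (f : ℕ → Carrier) (q : ℕ) : Set ℓ where
    constructor doubling
    field doubled : f (suc q) ≈ double (f q)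
  open Doubles public

  -- Bits are stripped at q and at q + 1 alike: a leading 0 doubles both sums, a leading 1 makes
  -- both vanish. If all bits are used up, the sum of c^d over the roots of `A q` remains.
  rootSum-A-doubles : ∀ q d {e} → d ℕ.+ 2 ≤ D q → Bits e →
    Doubles (λ q → rootSum (A (length e ℕ.+ q)) (monomial q d e)) q
  rootSum-A-doubles q d le [] = doubling (rootSum-A-suc q _ (monomial-below q d [])
    (ℕₚ.<-≤-trans (d+gap<D q d 0 le) (ℕₚ.m≤m+n _ _)))
  rootSum-A-doubles q d {0 ∷ e} le (0∷ bs) = doubling (trans (rootSum-0∷ (suc q) d (ℕₚ.≤-trans le (ℕₚ.m≤m+n _ _)) bs)
    (+-cong ih ih))
    where ih = trans (doubled (rootSum-A-doubles q d le bs)) (sym (rootSum-0∷ q d le bs))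
  rootSum-A-doubles q d le (1∷ bs) = doubling (trans (rootSum-1∷ (suc q) d (ℕₚ.≤-trans le (ℕₚ.m≤m+n _ _)) bs)
    (sym (trans (+-cong z z) (+-identityˡ 0#))))
    where z = rootSum-1∷ q d le bs

-- Doubling for each factor, by reduction of exponents.

module Doubling {c ℓ} (R : CommutativeRing c ℓ) where
  open Poly R hiding (zero)
  open PolynomialRing R
  open EulerDerivation R
  open MonicDivision R
  open RootSums R
  open CriticalOrbit R
  open IntegerSolver R using (solve; _:=_; _:+_; :-_)

  doubles-+ : ∀ {q} {f g : ℕ → Carrier} → Doubles f q → Doubles g q → Doubles (λ q → f q + g q) q
  doubles-+ (doubling df) (doubling dg) = doubling (trans (+-cong df dg)
    (solve 2 (λ x y → x :+ x :+ (y :+ y) := x :+ y :+ (x :+ y)) refl _ _))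

  doubles-neg : ∀ {q} {f : ℕ → Carrier} → Doubles f q → Doubles (λ q → - f q) q
  doubles-neg (doubling df) = doubling (trans (-‿cong df) (solve 1 (λ x → :- (x :+ x) := :- x :+ :- x) refl _))

  -- The rewriting is used at q and at q + 1; asking for it at all q′ ≥ q covers both, and degree
  -- bounds valid at q persist upward.
  doubles-resp : ∀ {q} {f g : ℕ → Carrier} → (∀ q′ → q ≤ q′ → f q′ ≈ g q′) → Doubles g q → Doubles f q
  doubles-resp {q} e (doubling dg) = doubling (trans (e (suc q) (ℕₚ.n≤1+n q)) (trans dg (+-cong (sym (e q ℕₚ.≤-refl)) (sym (e q ℕₚ.≤-refl)))))

  -- Induction on the length: in b M² + c one of the two factors b M is replaced by its own
  -- expansion. The new errors b M · V and c stay within the degree `gap`.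
  w-ones : ∀ q {e} → Ones e →
    ∃ λ V → b (length e ℕ.+ q) ≋ b q *ₚ w q e +ₚ V × DegBelow (suc (gap q (length e))) V
  w-ones q [] = [] , P.sym (P.trans (P.+-identityʳ _) (P.*-identityʳ _)) , below-[]
  w-ones q {1 ∷ e} (1∷ os) with w-ones q os
  ... | V , eq , dV = b M *ₚ V +ₚ Xₚ
    , P.trans (b-suc M) (P.trans (P.+-congʳ {Xₚ} (P.*-congˡ {b M} eq))
        (S.solve 5 (λ m p v V x → m S.:* (p S.:* v S.:+ V) S.:+ x S.:= p S.:* (m S.:* S.:1 S.:* v) S.:+ (m S.:* V S.:+ x))
          P.refl (b M) (b q) (w q e) V Xₚ))
    , below-+ (below-*-suc (b-below M) dV)
        (below-mono (s≤s (ℕₚ.≤-trans (D≥1 M) (ℕₚ.m≤m+n _ _))) below-X)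
    where M = length e ℕ.+ q

  rootSum-H-hasZero : ∀ q d {x e} → d ℕ.+ 2 ≤ D q → HasZero (x ∷ e) →
    rootSum (H q (length e)) (monomial q d (x ∷ e)) ≈ rootSum (A (suc (length e) ℕ.+ q)) (monomial q d (x ∷ e))
  rootSum-H-hasZero q d {x} {e} le hz with w-below-hasZero q hz
  ... | r , r≤ , dw = rootSum-stable (H q (length e)) (A (suc (length e) ℕ.+ q)) (b q) _ P.refl ≡.refl
    (below-*-suc (below-X^ d) dw) (b-below q) (begin
      suc (d ℕ.+ r ℕ.+ D q)          ≡⟨ ≡.cong suc (ℕₚ.+-assoc d r _) ⟩
      suc (d ℕ.+ (r ℕ.+ D q))        ≤⟨ s≤s (ℕₚ.+-monoʳ-≤ d r≤) ⟩
      suc (d ℕ.+ gap q k)            ≡⟨ ℕₚ.+-comm 1 _ ⟩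
      d ℕ.+ gap q k ℕ.+ 1            ≤⟨ ℕₚ.<⇒≤ (d+gap<D q d k le) ⟩
      D (k ℕ.+ q)                    ∎)
    where
    k = suc (length e)
    open ℕₚ.≤-Reasoning

  -- Here b q · w q e differs from the leading term of H q k by terms of low degree, so the
  -- correction is the one obtained when H q k is replaced by b q · w q e.

  rootSum-H-ones : ∀ q d {x e} → d ℕ.+ 2 ≤ D q → Ones (x ∷ e) →
    rootSum (H q (length e)) (monomial q d (x ∷ e)) ≈
      rootSum (A (suc (length e) ℕ.+ q)) (monomial q d (x ∷ e))
        + (rootSum (A q) (Xₚ ^ₚ d) + - rootSum (A (suc (length e) ℕ.+ q)) (Xₚ ^ₚ d))
  rootSum-H-ones q d {x} {e} le os with w-ones q os
  ... | V , eq , dV = trans (rootSum-perturb B (A M) (b q) _ P.refl) (+-congˡ (begin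
      -- The fraction W / B may be replaced by 1 / b q: the cross difference W · b q - B is -(V + b
      -- q), of degree at most `gap q (suc k)`.
      ct (B · A M) (f *ₚ W *ₚ Δ)            ≈⟨ ct-close (B · A M) (A q · A M) _ (f *ₚ Δ) (f *ₚ Δ *ₚ (-ₚ (V +ₚ b q) *ₚ b M)) crossMultiply small ⟩
      ct (A q · A M) (f *ₚ Δ)               ≈⟨ solve 2 (λ x y → x := y :+ x :+ :- y) refl _ _ ⟩
      rootSum (A M) f + ct (A q · A M) (f *ₚ Δ) + - rootSum (A M) f
                                            ≈⟨ +-congʳ (rootSum-difference (A q) (A M) f) ⟨
      rootSum (A q) f + - rootSum (A M) f   ∎))
    where
    open import Relation.Binary.Reasoning.Setoid setoid
    k = length e
    M = suc k ℕ.+ q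
    B = H q k
    f = Xₚ ^ₚ d
    W = w q (x ∷ e)
    Δ = wronskian (b q) (b M)

    bqW : b q *ₚ W ≋ b M +ₚ -ₚ V
    bqW = P.trans (S.solve 2 (λ y V → y S.:= y S.:+ V S.:+ S.:- V) P.refl (b q *ₚ W) V) (P.+-congʳ { -ₚ V} (P.sym eq))

    crossMultiply : f *ₚ W *ₚ Δ *ₚ (b q *ₚ b M) ≋
      f *ₚ Δ *ₚ ((b M +ₚ b q) *ₚ b M) +ₚ f *ₚ Δ *ₚ (-ₚ (V +ₚ b q) *ₚ b M)
    crossMultiply = P.trans
      (S.solve 5 (λ f W Δ p m → f S.:* W S.:* Δ S.:* (p S.:* m) S.:= (f S.:* Δ S.:* m) S.:* (p S.:* W)) P.refl f W Δ (b q) (b M))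
      (P.trans (P.*-congˡ {f *ₚ Δ *ₚ b M} bqW)
      (S.solve 5 (λ f V Δ p m → (f S.:* Δ S.:* m) S.:* (m S.:+ S.:- V) S.:=
        f S.:* Δ S.:* ((m S.:+ p) S.:* m) S.:+ f S.:* Δ S.:* (S.:- (V S.:+ p) S.:* m)) P.refl f V Δ (b q) (b M)))

    small : DegBelow ((D M ℕ.+ D M) ℕ.+ (D q ℕ.+ D M)) (f *ₚ Δ *ₚ (-ₚ (V +ₚ b q) *ₚ b M))
    small = below-mono bound≤
      (below-*-suc (below-*-suc (below-X^ d) (below-wronskian (b-below q) (b-below M)))
        (below-*-suc (below-neg (below-+ dV (below-mono (s≤s (ℕₚ.≤-trans (D-mono k q) (ℕₚ.m≤m+n _ _))) (b-below q)))) (b-below M)))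
      where
      bound≤ : suc ((d ℕ.+ (D q ℕ.+ D M)) ℕ.+ (gap q (suc k) ℕ.+ D M)) ≤ (D M ℕ.+ D M) ℕ.+ (D q ℕ.+ D M)
      bound≤ = ℕR.begin
        suc ((d ℕ.+ (D q ℕ.+ D M)) ℕ.+ (gap q (suc k) ℕ.+ D M))
          ℕR.≡⟨ rearrange d (gap q (suc k)) (D q) (D M) ⟩
        (d ℕ.+ gap q (suc k) ℕ.+ 1) ℕ.+ (D M ℕ.+ (D q ℕ.+ D M))
          ℕR.≤⟨ ℕₚ.+-monoˡ-≤ _ (ℕₚ.<⇒≤ (d+gap<D q d (suc k) le)) ⟩
        D M ℕ.+ (D M ℕ.+ (D q ℕ.+ D M))
          ℕR.≡⟨ ℕₚ.+-assoc (D M) (D M) _ ⟨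
        (D M ℕ.+ D M) ℕ.+ (D q ℕ.+ D M) ℕR.∎
        where
        module ℕR = ℕₚ.≤-Reasoning
        rearrange : ∀ d g p m → suc ((d ℕ.+ (p ℕ.+ m)) ℕ.+ (g ℕ.+ m)) ≡ (d ℕ.+ g ℕ.+ 1) ℕ.+ (m ℕ.+ (p ℕ.+ m))
        rearrange = ℕSolver.solve-∀

  D-lower : ∀ {q d} q′ → d ℕ.+ 2 ≤ D q → q ≤ q′ → d ℕ.+ 2 ≤ D q′
  D-lower {q} q′ le q≤q′ with ℕₚ.m≤n⇒∃[o]m+o≡n q≤q′
  ... | o , ≡.refl = ℕₚ.≤-trans le (≡.subst (λ n → D q ≤ D n) (ℕₚ.+-comm o q) (D-mono o q))

  rootSum-A-X^ : ∀ q d k → d ℕ.+ 2 ≤ D q → Doubles (λ q → rootSum (A (k ℕ.+ q)) (Xₚ ^ₚ d)) q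
  rootSum-A-X^ q d k le = doubling (trans (reflexive (≡.cong (λ n → rootSum (A n) (Xₚ ^ₚ d)) (ℕₚ.+-suc k q)))
    (rootSum-A-suc (k ℕ.+ q) _ (below-X^ d) (begin-strict
      d ℕ.+ 1                         <⟨ ℕₚ.+-monoʳ-< d (s≤s (s≤s z≤n)) ⟩
      d ℕ.+ 2                         ≤⟨ le ⟩
      D q                             ≤⟨ D-mono k q ⟩
      D (k ℕ.+ q)                     ≤⟨ ℕₚ.m≤m+n _ _ ⟩
      D (suc (k ℕ.+ q))               ∎)))
    where open ℕₚ.≤-Reasoning

  -- For a proper subset `H` is interchangeable with `A`. For the full set the correction is a
  -- difference of two sums of c^d, each of which doubles as well.
  bits-double : ∀ q d {x e} → d ℕ.+ 2 ≤ D q → Bits (x ∷ e) →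
    Doubles (λ q → rootSum (H q (length e)) (monomial q d (x ∷ e))) q
  bits-double q d {x} {e} le bs with ones? bs
  ... | inj₂ hz = doubles-resp (λ q′ q≤q′ → rootSum-H-hasZero q′ d (D-lower q′ le q≤q′) hz) (rootSum-A-doubles q d le bs)
  ... | inj₁ os = doubles-resp (λ q′ q≤q′ → rootSum-H-ones q′ d (D-lower q′ le q≤q′) os)
    (doubles-+ (rootSum-A-doubles q d le bs)
      (doubles-+ (rootSum-A-X^ q d 0 le) (doubles-neg (rootSum-A-X^ q d (suc (length e)) le))))

  -- Reduces e to e′ and e″ is one application of b j ² = b (j + 1) − c.

  data Reduces : (e e′ e″ : List ℕ) → Set where
    here  : ∀ {y x e} → Reduces (y ∷ 2 ℕ.+ x ∷ e) (suc y ∷ x ∷ e) (y ∷ x ∷ e)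
    there : ∀ {z e e′ e″} → Reduces e e′ e″ → Reduces (z ∷ e) (z ∷ e′) (z ∷ e″)

  -- A square below the top index is removed by the orbit recursion alone; a square at the top index
  -- needs the relation given by `H`.
  data Shape : List ℕ → Set where
    bits  : ∀ {e} → Bits e → Shape e
    inner : ∀ {e e′ e″} → Reduces e e′ e″ → Shape e
    top   : ∀ {x e} → Shape (2 ℕ.+ x ∷ e)

  shape : ∀ e → Shape e
  shape [] = bits []
  shape (z ∷ e) with shape e
  shape (z ∷ e) | inner r = inner (there r)
  shape (z ∷ _) | top = inner here
  shape (zero ∷ e) | bits bs = bits (0∷ bs)
  shape (suc zero ∷ e) | bits bs = bits (1∷ bs)
  shape (suc (suc z) ∷ e) | bits bs = top

  reduces-length : ∀ {e e′ e″} → Reduces e e′ e″ → length e′ ≡ length e × length e″ ≡ length e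
  reduces-length here = ≡.refl , ≡.refl
  reduces-length (there r) with reduces-length r
  ... | p , p′ = ≡.cong suc p , ≡.cong suc p′

  -- Both exponent sums drop, so the reduction terminates. The term in e″ gains a factor c, so the
  -- drop by 2 keeps the weight 2d + sum constant there.
  reduces-sum : ∀ {e e′ e″} → Reduces e e′ e″ → suc (sum e′) ≡ sum e × 2 ℕ.+ sum e″ ≡ sum e
  reduces-sum {y ∷ 2+x ∷ e} here = eq₁ y _ (sum e) , eq₂ y _ (sum e)
    where
    eq₁ : ∀ y x s → suc (suc y ℕ.+ (x ℕ.+ s)) ≡ y ℕ.+ (suc (suc x) ℕ.+ s)
    eq₁ = ℕSolver.solve-∀
    eq₂ : ∀ y x s → 2 ℕ.+ (y ℕ.+ (x ℕ.+ s)) ≡ y ℕ.+ (suc (suc x) ℕ.+ s)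
    eq₂ = ℕSolver.solve-∀
  reduces-sum {z ∷ e} (there r) with reduces-sum r
  ... | p , p′ = ≡.trans (≡.sym (ℕₚ.+-suc z _)) (≡.cong (z ℕ.+_) p)
    , ≡.trans (ℕₚ.+-comm 2 _) (≡.trans (ℕₚ.+-assoc z _ 2) (≡.cong (z ℕ.+_) (≡.trans (ℕₚ.+-comm _ 2) p′)))

  w-reduces : ∀ q {e e′ e″} → Reduces e e′ e″ → w q e ≋ w q e′ +ₚ -ₚ (Xₚ *ₚ w q e″)
  w-reduces q {y ∷ suc (suc x) ∷ e} here = P.trans
    (S.solve 5 (λ u s t v c → u S.:* (s S.:* (s S.:* t) S.:* v) S.:=
      (s S.:* s S.:+ c) S.:* u S.:* (t S.:* v) S.:+ S.:- (c S.:* (u S.:* (t S.:* v))))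
      P.refl (b (suc j) ^ₚ y) (b j) (b j ^ₚ x) (w q e) Xₚ)
    (P.+-congʳ { -ₚ (Xₚ *ₚ (b (suc j) ^ₚ y *ₚ (b j ^ₚ x *ₚ w q e)))}
      (P.*-congʳ {b j ^ₚ x *ₚ w q e} (P.*-congʳ {b (suc j) ^ₚ y} (P.sym (b-suc j)))))
    where j = length e ℕ.+ q
  w-reduces q {z ∷ e} {z ∷ e′} {z ∷ e″} (there r) with reduces-length r
  ... | p , p′ rewrite p | p′ = P.trans (P.*-congˡ {u} (w-reduces q r))
    (S.solve 4 (λ u s t c → u S.:* (s S.:+ S.:- (c S.:* t)) S.:= u S.:* s S.:+ S.:- (c S.:* (u S.:* t)))
      P.refl u (w q e′) (w q e″) Xₚ)
    where u = b (length e ℕ.+ q) ^ₚ z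

  monomial-reduces : ∀ q d {e e′ e″} → Reduces e e′ e″ →
    monomial q d e ≋ monomial q d e′ +ₚ -ₚ monomial q (suc d) e″
  monomial-reduces q d {e} {e′} {e″} r = P.trans (P.*-congˡ {Xₚ ^ₚ d} (w-reduces q r))
    (S.solve 4 (λ f x s t → f S.:* (s S.:+ S.:- (x S.:* t)) S.:= f S.:* s S.:+ S.:- (x S.:* f S.:* t))
      P.refl (Xₚ ^ₚ d) Xₚ (w q e′) (w q e″))

  -- The last exponent belongs to `b q`, so this multiplies the product by `b q`.
  incLast : List ℕ → List ℕ
  incLast [] = []
  incLast (x ∷ []) = suc x ∷ []
  incLast (x ∷ e@(_ ∷ _)) = x ∷ incLast e

  incLast-length : ∀ e → length (incLast e) ≡ length e
  incLast-length [] = ≡.refl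
  incLast-length (x ∷ []) = ≡.refl
  incLast-length (x ∷ e@(_ ∷ _)) = ≡.cong suc (incLast-length e)

  incLast-sum : ∀ x e → sum (incLast (x ∷ e)) ≡ suc (sum (x ∷ e))
  incLast-sum x [] = ≡.refl
  incLast-sum x e@(y ∷ e′) = ≡.trans (≡.cong (x ℕ.+_) (incLast-sum y e′)) (ℕₚ.+-suc x _)

  w-incLast : ∀ q x e → w q (incLast (x ∷ e)) ≋ b q *ₚ w q (x ∷ e)
  w-incLast q x [] = P.*-assoc (b q) (b q ^ₚ x) oneₚ
  w-incLast q x e@(y ∷ e′) rewrite incLast-length e = P.trans
    (P.*-congˡ {u} (w-incLast q y e′))
    (S.solve 3 (λ u s t → u S.:* (s S.:* t) S.:= s S.:* (u S.:* t)) P.refl u (b q) (w q e))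
    where u = b (length e ℕ.+ q) ^ₚ x

  -- Since `H` is b M² + c + b q, the square b M² is congruent to -b q - c modulo `H`: the orbit
  -- closes up, and the top index feeds the lowest one.
  monomial-top : ∀ q d x e → monomial q d (2 ℕ.+ x ∷ e) ≋
    (-ₚ monomial q d (incLast (x ∷ e)) +ₚ -ₚ monomial q (suc d) (x ∷ e))
      +ₚ monomial q d (x ∷ e) *ₚ pol (H q (length e))
  monomial-top q d x e = P.trans
    (S.solve 6 (λ f s t v c p → f S.:* (s S.:* (s S.:* t) S.:* v) S.:=
      (S.:- (f S.:* (p S.:* (t S.:* v))) S.:+ S.:- (c S.:* f S.:* (t S.:* v))) S.:+ f S.:* (t S.:* v) S.:* (s S.:* s S.:+ c S.:+ p))
      P.refl (Xₚ ^ₚ d) (b M) (b M ^ₚ x) (w q e) Xₚ (b q))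
    (P.+-cong
      (P.+-congʳ { -ₚ monomial q (suc d) (x ∷ e)} (P.-‿cong (P.*-congˡ {Xₚ ^ₚ d} (P.sym (w-incLast q x e)))))
      (P.*-congˡ {monomial q d (x ∷ e)} (P.+-congʳ {b q} (P.sym (b-suc M)))))
    where M = length e ℕ.+ q

  -- The reductions have the same form for every q, so doubling passes from the reduced monomials to
  -- the original. The recursion consumes `sum e`, with n as fuel, while the weight bound N keeps
  -- each d that arises within the range of `small`.
  monomial-doubles : ∀ q N → (∀ d → 2 ℕ.* d ≤ N → d ℕ.+ 2 ≤ D q) → ∀ k e d → length e ≡ suc k →
    2 ℕ.* d ℕ.+ sum e ≤ N → Doubles (λ q → rootSum (H q k) (monomial q d e)) q
  monomial-doubles q N small k e = go (suc (sum e)) e ℕₚ.≤-refl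
    where
    Goal : ℕ → List ℕ → Set ℓ
    Goal d e = Doubles (λ q → rootSum (H q k) (monomial q d e)) q

    weight-inc : ∀ d {s t} → 2 ℕ.+ s ≡ t → 2 ℕ.* d ℕ.+ t ≤ N → 2 ℕ.* suc d ℕ.+ s ≤ N
    weight-inc d {s} ≡.refl le = ℕₚ.≤-trans (ℕₚ.≤-reflexive (eq d s)) le
      where
      eq : ∀ d s → 2 ℕ.* suc d ℕ.+ s ≡ 2 ℕ.* d ℕ.+ (2 ℕ.+ s)
      eq = ℕSolver.solve-∀

    weight-dec : ∀ d {s t} → suc s ≡ t → 2 ℕ.* d ℕ.+ t ≤ N → 2 ℕ.* d ℕ.+ s ≤ N
    weight-dec d ≡.refl le = ℕₚ.≤-trans (ℕₚ.+-monoʳ-≤ (2 ℕ.* d) (ℕₚ.n≤1+n _)) le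

    go : ∀ n e → sum e < n → ∀ d → length e ≡ suc k → 2 ℕ.* d ℕ.+ sum e ≤ N → Goal d e
    go (suc n) e (s≤s e≤n) d len wt with shape e
    go (suc n) (x ∷ e) (s≤s e≤n) d ≡.refl wt | bits bs =
      bits-double q d (small d (ℕₚ.≤-trans (ℕₚ.m≤m+n _ _) wt)) bs
    go (suc n) e (s≤s e≤n) d len wt | inner {e′ = e′} {e″} r = doubles-resp
      (λ q _ → trans (rootSum-cong (H q k) (monomial-reduces q d r))
        (trans (rootSum-+ (H q k) (monomial q d e′) (-ₚ monomial q (suc d) e″)) (+-congˡ (rootSum-neg (H q k) (monomial q (suc d) e″)))))
      (doubles-+
        (go n e′ (ℕₚ.≤-trans (ℕₚ.≤-reflexive (proj₁ sums)) e≤n) d (≡.trans (proj₁ lens) len) (weight-dec d (proj₁ sums) wt))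
        (doubles-neg (go n e″ (ℕₚ.≤-trans (ℕₚ.n≤1+n _) (ℕₚ.≤-trans (ℕₚ.≤-reflexive (proj₂ sums)) e≤n)) (suc d)
          (≡.trans (proj₂ lens) len) (weight-inc d (proj₂ sums) wt))))
      where
      sums = reduces-sum r
      lens = reduces-length r
    go (suc n) (_ ∷ e) (s≤s e≤n) d ≡.refl wt | top {x} = doubles-resp
      (λ q _ → trans (rootSum-mod (H q k) (monomial q d (x ∷ e)) (monomial-top q d x e))
        (trans (rootSum-+ (H q k) (-ₚ monomial q d (incLast (x ∷ e))) (-ₚ monomial q (suc d) (x ∷ e)))
          (+-cong (rootSum-neg (H q k) (monomial q d (incLast (x ∷ e)))) (rootSum-neg (H q k) (monomial q (suc d) (x ∷ e))))))
      (doubles-+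
        (doubles-neg (go n (incLast (x ∷ e)) (ℕₚ.≤-trans (ℕₚ.≤-reflexive (≡.cong suc (incLast-sum x e))) e≤n) d
          (incLast-length (x ∷ e)) (weight-dec d (≡.cong suc (incLast-sum x e)) wt)))
        (doubles-neg (go n (x ∷ e) (ℕₚ.≤-trans (ℕₚ.n≤1+n _) e≤n) (suc d) ≡.refl (weight-inc d ≡.refl wt))))

-- Newton's identities and leading coefficients.

module NewtonIdentities {c ℓ} (R : CommutativeRing c ℓ) where
  open Poly R hiding (zero)
  open PolynomialRing R
  open EulerDerivation R
  open MonicDivision R
  open RootSums R
  open IntegerSolver R using (solve; _:=_; _:+_; _:*_; :-_; :0; :1)

  -- Coefficients of ∏ (1 − x t), i.e. elementary symmetric functions with signs.

  elem : List Carrier → ℕ → Carrier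
  elem [] zero = 1#
  elem [] (suc i) = 0#
  elem (x ∷ xs) zero = elem xs zero
  elem (x ∷ xs) (suc i) = elem xs (suc i) + - (x * elem xs i)

  powerSum : List Carrier → ℕ → Carrier
  powerSum xs i = sumBy (λ x → pow x i) xs

  shift : (ℕ → Carrier) → ℕ → Carrier
  shift f zero = 0#
  shift f (suc i) = f i

  conv-shift : ∀ f g i → conv f (shift g) i ≈ shift (conv f g) i
  conv-shift f g zero = zeroʳ _
  conv-shift f g (suc i) = trans (conv-sucʳ f (shift g) i) (trans (+-congˡ (zeroʳ _)) (+-identityʳ _))

  conv-distribˡ : ∀ f g g′ x i → conv f (λ j → g j + - (x * g′ j)) i ≈ conv f g i + - (x * conv f g′ i)
  conv-distribˡ f g g′ x zero = solve 4 (λ f g h x → f :* (g :+ :- (x :* h)) := f :* g :+ :- (x :* (f :* h))) refl _ _ _ _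
  conv-distribˡ f g g′ x (suc i) = trans (+-congˡ (conv-distribˡ (λ j → f (suc j)) g g′ x i))
    (solve 6 (λ f g h x u v → f :* (g :+ :- (x :* h)) :+ (u :+ :- (x :* v)) := f :* g :+ u :+ :- (x :* (f :* h :+ v))) refl _ _ _ _ _ _)

  elem-∷ : ∀ x xs i → elem (x ∷ xs) i ≈ elem xs i + - (x * shift (elem xs) i)
  elem-∷ x xs zero = solve 2 (λ e x → e := e :+ :- (x :* :0)) refl _ _
  elem-∷ x xs (suc i) = refl

  -- As power series in t: x / (1 - x t) times (1 - x t) E is x E.
  conv-geometric : ∀ x xs i → conv (λ j → pow x (suc j)) (elem (x ∷ xs)) i ≈ x * elem xs i
  conv-geometric x xs zero = *-congʳ (*-identityʳ x)
  conv-geometric x xs (suc i) = trans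
    (+-congˡ (trans (conv-scale x (λ j → pow x (suc j)) (elem (x ∷ xs)) i) (*-congˡ (conv-geometric x xs i))))
    (solve 3 (λ x e f → x :* :1 :* (e :+ :- (x :* f)) :+ x :* (x :* f) := x :* e) refl x _ _)

  -- These are the coefficients of t E′ + t P E = 0 with P = Σ p_{j+1} t^j, where `shift` is
  -- multiplication by t. A further root x multiplies the left side by 1 - x t.
  newton : ∀ xs i → natCast i * elem xs i + shift (conv (λ j → powerSum xs (suc j)) (elem xs)) i ≈ 0#
  newton xs zero = solve 1 (λ e → :0 :* e :+ :0 := :0) refl _
  newton [] (suc i) = trans (+-cong (zeroʳ _) (conv-zeroˡ _ (λ _ → refl) i)) (+-identityˡ 0#)
  newton (x ∷ xs) (suc i) = begin
    (1# + natCast i) * (E (suc i) + - (x * E i)) + conv (λ j → pow x (suc j) + P j) (elem (x ∷ xs)) i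
      ≈⟨ +-congˡ (trans (conv-distribʳ (λ j → pow x (suc j)) P (elem (x ∷ xs)) i) (+-cong (conv-geometric x xs i)
           (trans (conv-cong {f = P} (λ _ → refl) (elem-∷ x xs) i) (trans (conv-distribˡ P E (shift E) x i) (+-congˡ (-‿cong (*-congˡ (conv-shift P E i)))))))) ⟩
    (1# + natCast i) * (E (suc i) + - (x * E i)) + (x * E i + (conv P E i + - (x * shift (conv P E) i)))
      ≈⟨ solve 6 (λ n x e e′ c c′ → (:1 :+ n) :* (e′ :+ :- (x :* e)) :+ (x :* e :+ (c :+ :- (x :* c′)))
           := ((:1 :+ n) :* e′ :+ c) :+ :- (x :* (n :* e :+ c′))) refl (natCast i) x (E i) (E (suc i)) (conv P E i) _ ⟩
    ((1# + natCast i) * E (suc i) + conv P E i) + - (x * (natCast i * E i + shift (conv P E) i))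
      ≈⟨ +-cong (newton xs (suc i)) (-‿cong (*-congˡ (newton xs i))) ⟩
    0# + - (x * 0#)
      ≈⟨ solve 1 (λ x → :0 :+ :- (x :* :0) := :0) refl x ⟩
    0# ∎
    where
    open import Relation.Binary.Reasoning.Setoid setoid
    E P : ℕ → Carrier
    E = elem xs
    P j = powerSum xs (suc j)

  conv-cong-≤ : ∀ {f f′ g g′} i → (∀ j → j ≤ i → f j ≈ f′ j) → (∀ j → j ≤ i → g j ≈ g′ j) → conv f g i ≈ conv f′ g′ i
  conv-cong-≤ zero f≈ g≈ = *-cong (f≈ 0 z≤n) (g≈ 0 z≤n)
  conv-cong-≤ (suc i) f≈ g≈ = +-cong (*-cong (f≈ 0 z≤n) (g≈ (suc i) ℕₚ.≤-refl))
    (conv-cong-≤ i (λ j j≤i → f≈ (suc j) (s≤s j≤i)) (λ j j≤i → g≈ j (ℕₚ.m≤n⇒m≤1+n j≤i)))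

  elem-0 : ∀ xs → elem xs 0 ≈ 1#
  elem-0 [] = refl
  elem-0 (x ∷ xs) = elem-0 xs

  module _ (isDomain : IsIntegralDomain) (charZero : CharZero) where

    domain-cancel : ∀ {a x y} → ¬ a ≈ 0# → a * x ≈ a * y → x ≈ y
    domain-cancel {a} {x} {y} a≉0 e = x∙y⁻¹≈ε⇒x≈y x y (conclude (proj₂ isDomain a (x + - y) difference≈0))
      where
      open import Algebra.Properties.Group +-group using (x∙y⁻¹≈ε⇒x≈y)
      difference≈0 : a * (x + - y) ≈ 0#
      difference≈0 = trans (solve 3 (λ a x y → a :* (x :+ :- y) := a :* x :+ :- (a :* y)) refl a x y)
        (trans (+-congʳ e) (-‿inverseʳ _))
      conclude : a ≈ 0# ⊎ x + - y ≈ 0# → x + - y ≈ 0#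
      conclude (inj₁ a≈0) = ⊥-elim (a≉0 a≈0)
      conclude (inj₂ z) = z

    -- In the identity of index i + 1 the new coefficient carries the factor i + 1, cancellable in a
    -- domain of characteristic 0; every other term has a lower index or is a power sum.
    powerSums⇒elem : ∀ xs ys i → (∀ j → 1 ≤ j → j ≤ i → powerSum xs j ≈ powerSum ys j) →
      ∀ j → j ≤ i → elem xs j ≈ elem ys j
    powerSums⇒elem xs ys i e zero _ = trans (elem-0 xs) (sym (elem-0 ys))
    powerSums⇒elem xs ys (suc i) e (suc j) (s≤s j≤i) with ℕₚ.m≤n⇒m<n∨m≡n j≤i
    ... | inj₁ j<i = powerSums⇒elem xs ys i (λ k 1≤k k≤i → e k 1≤k (ℕₚ.m≤n⇒m≤1+n k≤i)) (suc j) j<i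
    ... | inj₂ ≡.refl = domain-cancel (charZero i) (begin
      n * elem xs (suc i)             ≈⟨ solve 2 (λ x y → x := x :+ y :+ :- y) refl _ _ ⟩
      n * elem xs (suc i) + cx + - cx ≈⟨ +-congʳ (trans (newton xs (suc i)) (sym (newton ys (suc i)))) ⟩
      n * elem ys (suc i) + cy + - cx ≈⟨ +-congˡ (-‿cong (conv-cong-≤ i (λ j j≤i → e (suc j) (s≤s z≤n) (s≤s j≤i))
                                          (powerSums⇒elem xs ys i (λ k 1≤k k≤i → e k 1≤k (ℕₚ.m≤n⇒m≤1+n k≤i))))) ⟩
      n * elem ys (suc i) + cy + - cy ≈⟨ solve 2 (λ x y → x := x :+ y :+ :- y) refl _ _ ⟨
      n * elem ys (suc i)             ∎)
      where
      open import Relation.Binary.Reasoning.Setoid setoid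
      n = natCast (suc i)
      cx = conv (λ j → powerSum xs (suc j)) (elem xs) i
      cy = conv (λ j → powerSum ys (suc j)) (elem ys) i

  coeffTop-≤ : ∀ p {d i} → i ≤ d → coeffTop p d i ≡ coeff p (d ℕ.∸ i)
  coeffTop-≤ p {d} {i} i≤d with i ℕ.≤ᵇ d in eq
  ... | true = ≡.refl
  ... | false = ⊥-elim (≡.subst T eq (ℕₚ.≤⇒≤ᵇ i≤d))

  coeffTop-> : ∀ p {d i} → d < i → coeffTop p d i ≡ 0#
  coeffTop-> p {d} {i} d<i with i ℕ.≤ᵇ d in eq
  ... | false = ≡.refl
  ... | true = ⊥-elim (ℕₚ.<⇒≱ d<i (ℕₚ.≤ᵇ⇒≤ i d (≡.subst T (≡.sym eq) _)))

  coeff-linear-* : ∀ x p i → coeff ((X- x) *ₚ p) i ≈ shift (coeff p) i + - (x * coeff p i)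
  coeff-linear-* x p zero = trans (coeff-* (X- x) p 0) (solve 2 (λ x p → :- x :* p := :0 :+ :- (x :* p)) refl _ _)
  coeff-linear-* x p (suc i) = trans (coeff-* (X- x) p (suc i))
    (trans (+-congˡ (trans (sym (coeff-* oneₚ p i)) (at (P.*-identityˡ p) i)))
      (solve 3 (λ x p q → :- x :* p :+ q := q :+ :- (x :* p)) refl _ _ _))

  -- Read from the top, multiplication by X - x becomes multiplication by 1 - x t, the recursion of
  -- `elem`.
  coeffTop-linear-* : ∀ x p d i → DegBelow (suc d) p →
    coeffTop ((X- x) *ₚ p) (suc d) i ≈ coeffTop p d i + - (x * shift (coeffTop p d) i)
  coeffTop-linear-* x p d zero dp = trans (coeff-linear-* x p (suc d))
    (+-congˡ (-‿cong (*-congˡ (vanish dp (suc d) ℕₚ.≤-refl))))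
  coeffTop-linear-* x p d (suc i) dp with ℕₚ.<-cmp i d
  ... | tri> _ _ d<i = trans (reflexive (coeffTop-> ((X- x) *ₚ p) (s≤s d<i)))
    (sym (trans (+-cong (reflexive (coeffTop-> p (ℕₚ.m<n⇒m<1+n d<i))) (-‿cong (*-congˡ (reflexive (coeffTop-> p d<i)))))
      (solve 1 (λ x → :0 :+ :- (x :* :0) := :0) refl x)))
  -- Index d + 1 lies beyond the constant term of p, where the default value `0#` of `coeffTop` is
  -- what the recursion needs.
  ... | tri≈ _ ≡.refl _ = begin
    coeffTop ((X- x) *ₚ p) (suc d) (suc d)      ≡⟨ coeffTop-≤ ((X- x) *ₚ p) (ℕₚ.≤-refl {suc d}) ⟩
    coeff ((X- x) *ₚ p) (d ℕ.∸ d)               ≡⟨ ≡.cong (coeff ((X- x) *ₚ p)) (ℕₚ.n∸n≡0 d) ⟩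
    coeff ((X- x) *ₚ p) 0                       ≈⟨ coeff-linear-* x p 0 ⟩
    0# + - (x * coeff p 0)                      ≡⟨ ≡.cong (λ n → 0# + - (x * coeff p n)) (ℕₚ.n∸n≡0 d) ⟨
    0# + - (x * coeff p (d ℕ.∸ d))              ≡⟨ ≡.cong₂ (λ u v → u + - (x * v)) (coeffTop-> p (ℕₚ.n<1+n d)) (coeffTop-≤ p (ℕₚ.≤-refl {d})) ⟨
    coeffTop p d (suc d) + - (x * coeffTop p d d) ∎
    where open import Relation.Binary.Reasoning.Setoid setoid
  ... | tri< (s≤s {n = d′} i≤d′) _ _ = begin
    coeffTop ((X- x) *ₚ p) (suc d) (suc i)      ≡⟨ coeffTop-≤ ((X- x) *ₚ p) (s≤s (ℕₚ.m≤n⇒m≤1+n i≤d′)) ⟩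
    coeff ((X- x) *ₚ p) (d ℕ.∸ i)               ≡⟨ ≡.cong (coeff ((X- x) *ₚ p)) (ℕₚ.+-∸-assoc 1 i≤d′) ⟩
    coeff ((X- x) *ₚ p) (suc (d′ ℕ.∸ i))        ≈⟨ coeff-linear-* x p (suc (d′ ℕ.∸ i)) ⟩
    coeff p (d′ ℕ.∸ i) + - (x * coeff p (suc (d′ ℕ.∸ i))) ≡⟨ ≡.cong (λ n → coeff p (d′ ℕ.∸ i) + - (x * coeff p n)) (ℕₚ.+-∸-assoc 1 i≤d′) ⟨
    coeff p (d′ ℕ.∸ i) + - (x * coeff p (d ℕ.∸ i)) ≡⟨ ≡.cong₂ (λ u v → u + - (x * v)) (coeffTop-≤ p (s≤s i≤d′)) (coeffTop-≤ p (ℕₚ.m≤n⇒m≤1+n i≤d′)) ⟨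
    coeffTop p d (suc i) + - (x * coeffTop p d i) ∎
    where open import Relation.Binary.Reasoning.Setoid setoid

  coeffTop-roots : ∀ xs i → coeffTop (prodₚ (map X-_ xs)) (length xs) i ≈ elem xs i
  coeffTop-roots [] zero = refl
  coeffTop-roots [] (suc i) = refl
  coeffTop-roots (x ∷ xs) i = trans (coeffTop-linear-* x (prodₚ (map X-_ xs)) (length xs) i (below xs))
    (trans (+-cong (coeffTop-roots xs i) (-‿cong (*-congˡ (shift-cong (coeffTop-roots xs) i)))) (sym (elem-∷ x xs i)))
    where
    below : ∀ xs → DegBelow (suc (length xs)) (prodₚ (map X-_ xs))
    below [] = below-const 1#
    below (x ∷ xs) = below-*-suc (bound (linear x)) (below xs)
    shift-cong : ∀ {f g} → (∀ i → f i ≈ g i) → ∀ i → shift f i ≈ shift g i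
    shift-cong e zero = refl
    shift-cong e (suc i) = e i

-- Power sums of the multipliers.

module Multipliers {c ℓ} (R : CommutativeRing c ℓ) where
  open Poly R hiding (zero)
  open PolynomialRing R
  open EulerDerivation R
  open MonicDivision R
  open RootSums R
  open CriticalOrbit R
  open Doubling R
  open NewtonIdentities R
  open IntegerSolver R using (solve; _:=_; _:+_; :-_)

  -- The highest index comes first, as in `w`.
  prodTo : (ℕ → Pol) → ℕ → Pol
  prodTo g zero = oneₚ
  prodTo g (suc n) = g n *ₚ prodTo g n

  prodₚ-∷ʳ : ∀ ps p → prodₚ (ps ∷ʳ p) ≋ p *ₚ prodₚ ps
  prodₚ-∷ʳ [] p = P.refl
  prodₚ-∷ʳ (r ∷ ps) p = P.trans (P.*-congˡ {r} (prodₚ-∷ʳ ps p))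
    (S.solve 3 (λ r p s → r S.:* (p S.:* s) S.:= p S.:* (r S.:* s)) P.refl r p (prodₚ ps))

  prodₚ-upTo : ∀ g n → prodₚ (map g (upTo n)) ≋ prodTo g n
  prodₚ-upTo g zero = P.refl
  prodₚ-upTo g (suc n) = begin
    prodₚ (map g (upTo (suc n)))       ≡⟨ ≡.cong (λ l → prodₚ (map g l)) (Listₚ.upTo-∷ʳ n) ⟨
    prodₚ (map g (upTo n ∷ʳ n))        ≡⟨ ≡.cong prodₚ (Listₚ.map-++ g (upTo n) (n ∷ [])) ⟩
    prodₚ (map g (upTo n) ∷ʳ g n)      ≈⟨ prodₚ-∷ʳ (map g (upTo n)) (g n) ⟩
    g n *ₚ prodₚ (map g (upTo n))      ≈⟨ P.*-congˡ {g n} (prodₚ-upTo g n) ⟩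
    g n *ₚ prodTo g n                  ∎
    where open import Relation.Binary.Reasoning.Setoid P.setoid

  prodTo-suc : ∀ g n → prodTo g (suc n) ≋ g 0 *ₚ prodTo (λ i → g (suc i)) n
  prodTo-suc g zero = P.refl
  prodTo-suc g (suc n) = P.trans (P.*-congˡ {g (suc n)} (prodTo-suc g n))
    (S.solve 3 (λ x y z → x S.:* (y S.:* z) S.:= y S.:* (x S.:* z)) P.refl (g (suc n)) (g 0) (prodTo (λ i → g (suc i)) n))

  prodTo-+ : ∀ g k n → prodTo g (k ℕ.+ n) ≋ prodTo (λ i → g (i ℕ.+ n)) k *ₚ prodTo g n
  prodTo-+ g zero n = P.sym (P.*-identityˡ _)
  prodTo-+ g (suc k) n = P.trans (P.*-congˡ {g (k ℕ.+ n)} (prodTo-+ g k n))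
    (P.sym (P.*-assoc (g (k ℕ.+ n)) (prodTo (λ i → g (i ℕ.+ n)) k) (prodTo g n)))

  module Congruence (B : Monic) where
    infix 4 _~_
    record _~_ (p r : Pol) : Set (c ⊔ ℓ) where
      constructor congruent
      field
        quotient : Pol
        split    : p ≋ r +ₚ quotient *ₚ pol B

    ~-reflexive : ∀ {p r} → p ≋ r → p ~ r
    ~-reflexive e = congruent [] (P.trans e (P.sym (P.+-identityʳ _)))

    ~-trans : ∀ {p r s} → p ~ r → r ~ s → p ~ s
    ~-trans {p} {r} {s} (congruent t e) (congruent t′ e′) = congruent (t′ +ₚ t)
      (P.trans e (P.trans (P.+-congʳ {t *ₚ pol B} e′)
        (S.solve 4 (λ s t t′ b → s S.:+ t′ S.:* b S.:+ t S.:* b S.:= s S.:+ (t′ S.:+ t) S.:* b) P.refl s t t′ (pol B))))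

    ~-+ : ∀ {p p′ r r′} → p ~ p′ → r ~ r′ → p +ₚ r ~ p′ +ₚ r′
    ~-+ {p} {p′} {r} {r′} (congruent t e) (congruent u f) = congruent (t +ₚ u) (P.trans (P.+-cong e f)
      (S.solve 5 (λ p r t u b → p S.:+ t S.:* b S.:+ (r S.:+ u S.:* b) S.:= p S.:+ r S.:+ (t S.:+ u) S.:* b)
        P.refl p′ r′ t u (pol B)))

    ~-* : ∀ {p p′ r r′} → p ~ p′ → r ~ r′ → p *ₚ r ~ p′ *ₚ r′
    ~-* {p} {p′} {r} {r′} (congruent t e) (congruent u f) = congruent (p′ *ₚ u +ₚ t *ₚ r′ +ₚ t *ₚ u *ₚ pol B)
      (P.trans (P.*-cong e f)
      (S.solve 5 (λ p r t u b → (p S.:+ t S.:* b) S.:* (r S.:+ u S.:* b) S.:=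
        p S.:* r S.:+ (p S.:* u S.:+ t S.:* r S.:+ t S.:* u S.:* b) S.:* b) P.refl p′ r′ t u (pol B)))

    ~-^ : ∀ {p r} n → p ~ r → p ^ₚ n ~ r ^ₚ n
    ~-^ zero e = ~-reflexive P.refl
    ~-^ (suc n) e = ~-* e (~-^ n e)

    ~-prodTo : ∀ {g h} n → (∀ i → g i ~ h i) → prodTo g n ~ prodTo h n
    ~-prodTo zero e = ~-reflexive P.refl
    ~-prodTo (suc n) e = ~-* (e n) (~-prodTo n e)

    rootSum-~ : ∀ {p r} → p ~ r → rootSum B p ≈ rootSum B r
    rootSum-~ (congruent t e) = rootSum-mod B t e

    ~0-*ˡ : ∀ {p} r → p ~ [] → p *ₚ r ~ []
    ~0-*ˡ {p} r (congruent t e) = congruent (r *ₚ t)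
      (P.trans (P.*-congʳ {r} e) (S.solve 3 (λ r t b → t S.:* b S.:* r S.:= r S.:* t S.:* b) P.refl r t (pol B)))

  -- multiplierₚ q n is λ_{m,n} as a polynomial in c, for m = q + 2.

  multiplierₚ : ℕ → ℕ → Pol
  multiplierₚ q n = const (pow (1# + 1#) n) *ₚ prodₚ (map (λ i → aₚ (2 ℕ.+ q ℕ.+ i)) (upTo n))

  eval-multiplier : ∀ q n α → eval (multiplierₚ q n) α ≈ multiplier (2 ℕ.+ q) n α
  eval-multiplier q n α = trans (eval-* (const _) (prodₚ (map (λ i → aₚ (2 ℕ.+ q ℕ.+ i)) (upTo n))) α)
    (*-cong (trans (+-congˡ (zeroʳ α)) (+-identityʳ _)) (eval-prod (λ i → eval-a (2 ℕ.+ q ℕ.+ i) α) (upTo n)))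

  -- The factors of λ start at a_m, one index above the lowest factor a_{m-1} of `w`; this offset
  -- produces the signs below.
  orbit : ℕ → ℕ → Pol
  orbit q i = b (i ℕ.+ suc q)

  orbit≡a : ∀ q i → orbit q i ≡ aₚ (2 ℕ.+ q ℕ.+ i)
  orbit≡a q i = ≡.trans (b≡a (i ℕ.+ suc q)) (≡.cong (λ n → aₚ (suc n)) (ℕₚ.+-comm i (suc q)))

  multiplierₚ-orbit : ∀ q n → multiplierₚ q n ≋ const (pow (1# + 1#) n) *ₚ prodTo (orbit q) n
  multiplierₚ-orbit q n = P.*-congˡ {const (pow (1# + 1#) n)} (P.trans
    (P.reflexive (≡.cong prodₚ (Listₚ.map-cong (λ i → ≡.sym (orbit≡a q i)) (upTo n))))
    (prodₚ-upTo (orbit q) n))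

  const-homo-* : ∀ a a′ → const a *ₚ const a′ ≋ const (a * a′)
  const-homo-* a a′ = coeffwise λ { zero → +-identityʳ _ ; (suc i) → refl }

  const-^ : ∀ a p n → (const a *ₚ p) ^ₚ n ≋ const (pow a n) *ₚ p ^ₚ n
  const-^ a p zero = P.sym (P.*-identityˡ oneₚ)
  const-^ a p (suc n) = P.trans (P.*-congˡ {const a *ₚ p} (const-^ a p n)) (P.trans
    (S.solve 4 (λ a p a′ p′ → a S.:* p S.:* (a′ S.:* p′) S.:= a S.:* a′ S.:* (p S.:* p′)) P.refl (const a) p (const (pow a n)) (p ^ₚ n))
    (P.*-congʳ {p *ₚ p ^ₚ n} (const-homo-* a (pow a n))))

  w-replicate : ∀ q x k → w q (replicate k x) ≋ prodTo (λ i → b (i ℕ.+ q)) k ^ₚ x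
  w-replicate q x zero = P.sym (one-^ x)
    where
    one-^ : ∀ x → oneₚ ^ₚ x ≋ oneₚ
    one-^ zero = P.refl
    one-^ (suc x) = P.trans (P.*-identityˡ _) (one-^ x)
  w-replicate q x (suc k) = P.trans
    (P.*-cong (P.reflexive (≡.cong (λ n → b (n ℕ.+ q) ^ₚ x) (Listₚ.length-replicate k))) (w-replicate q x k))
    (P.sym (^-distrib-* (b (k ℕ.+ q)) (prodTo (λ i → b (i ℕ.+ q)) k) x))

  module ModH (q k : ℕ) where
    open Congruence (H q k) public

    b-antiperiod : b (suc k ℕ.+ q) ~ -ₚ b q
    b-antiperiod = congruent oneₚ
      (S.solve 2 (λ x y → x S.:= S.:- y S.:+ S.:1 S.:* (x S.:+ y)) P.refl (b (suc k ℕ.+ q)) (b q))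

    -- The sign in `b-antiperiod` is lost at the next squaring, so the orbit repeats with period k +
    -- 1 from index q + 1 on.
    orbit-period : ∀ i → orbit q (i ℕ.+ suc k) ~ orbit q i
    orbit-period i = ~-trans (~-reflexive (P.reflexive (≡.cong b (eq i k q)))) (go i)
      where
      eq : ∀ i k q → i ℕ.+ suc k ℕ.+ suc q ≡ i ℕ.+ suc (suc k ℕ.+ q)
      eq = ℕSolver.solve-∀
      go : ∀ i → b (i ℕ.+ suc (suc k ℕ.+ q)) ~ b (i ℕ.+ suc q)
      go zero = ~-trans (~-reflexive (b-suc (suc k ℕ.+ q))) (~-trans
        (~-+ (~-* b-antiperiod b-antiperiod) (~-reflexive (P.refl {Xₚ})))
        (~-reflexive (P.trans (S.solve 2 (λ y x → S.:- y S.:* S.:- y S.:+ x S.:= y S.:* y S.:+ x) P.refl (b q) Xₚ) (P.sym (b-suc q)))))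
      go (suc i) = ~-trans (~-reflexive (b-suc (i ℕ.+ suc (suc k ℕ.+ q)))) (~-trans
        (~-+ (~-* (go i) (go i)) (~-reflexive (P.refl {Xₚ})))
        (~-reflexive (P.sym (b-suc (i ℕ.+ suc q)))))

    orbit-period-* : ∀ t i → orbit q (i ℕ.+ t ℕ.* suc k) ~ orbit q i
    orbit-period-* zero i = ~-reflexive (P.reflexive (≡.cong (orbit q) (ℕₚ.+-identityʳ i)))
    orbit-period-* (suc t) i = ~-trans
      (~-reflexive (P.reflexive (≡.cong (orbit q) (eq i (suc k) (t ℕ.* suc k)))))
      (~-trans (orbit-period (i ℕ.+ t ℕ.* suc k)) (orbit-period-* t i))
      where
      eq : ∀ i x y → i ℕ.+ (x ℕ.+ y) ≡ i ℕ.+ y ℕ.+ x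
      eq = ℕSolver.solve-∀

    W : Pol
    W = prodTo (λ i → b (i ℕ.+ q)) (suc k)

    -- The orbit product and `W` differ only at the ends: the former has b (q + k + 1) where the
    -- latter has b q, and these are opposite modulo `H`.
    one-period : prodTo (orbit q) (suc k) ~ const (- 1#) *ₚ W
    one-period = ~-trans
      (~-* (~-trans (~-reflexive (P.reflexive (≡.cong b (ℕₚ.+-suc k q)))) b-antiperiod) (~-reflexive (P.refl {prodTo (orbit q) k})))
      (~-reflexive (P.trans
        (S.solve 2 (λ y z → S.:- y S.:* z S.:= S.:- S.:1 S.:* (y S.:* z)) P.refl (b q) (prodTo (orbit q) k))
        (P.*-congˡ {const (- 1#)} (P.sym (P.trans (prodTo-suc (λ i → b (i ℕ.+ q)) k)
          (P.*-congˡ {b q} (prodTo-cong k)))))))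
      where
      prodTo-cong : ∀ n → prodTo (λ i → b (suc i ℕ.+ q)) n ≋ prodTo (orbit q) n
      prodTo-cong zero = P.refl
      prodTo-cong (suc n) = P.*-cong (P.reflexive (≡.cong b (≡.sym (ℕₚ.+-suc n q)))) (prodTo-cong n)

    periods : ∀ t → prodTo (orbit q) (t ℕ.* suc k) ~ const (pow (- 1#) t) *ₚ W ^ₚ t
    periods t = ~-trans (go t) (~-reflexive (const-^ (- 1#) W t))
      where
      go : ∀ t → prodTo (orbit q) (t ℕ.* suc k) ~ (const (- 1#) *ₚ W) ^ₚ t
      go zero = ~-reflexive P.refl
      go (suc t) = ~-trans (~-reflexive (prodTo-+ (orbit q) (suc k) (t ℕ.* suc k)))
        (~-* (~-trans (~-prodTo (suc k) (orbit-period-* t)) one-period) (go t))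

  -- The constant in λ^i, where t = n / (k + 1) counts the periods. It does not involve q, so
  -- doubling passes through it.
  scale : ℕ → ℕ → ℕ → Carrier
  scale n t i = pow (pow (1# + 1#) n * pow (- 1#) t) i

  rootSum-multiplier : ∀ q k t i → let n = t ℕ.* suc k in
    rootSum (H q k) (multiplierₚ q n ^ₚ i) ≈ scale n t i * rootSum (H q k) (monomial q 0 (replicate (suc k) (t ℕ.* i)))
  rootSum-multiplier q k t i = trans
    (rootSum-~ (~-trans (~-^ i (~-trans (~-reflexive (multiplierₚ-orbit q n)) (~-* (~-reflexive (P.refl {const two^n})) (periods t))))
      (~-reflexive (P.trans (^-congˡ i combine) (P.trans (const-^ (two^n * pow (- 1#) t) (W ^ₚ t) i) (P.*-congˡ {const (scale n t i)} powers))))))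
    (rootSum-const (H q k) (scale n t i) (monomial q 0 (replicate (suc k) (t ℕ.* i))))
    where
    open ModH q k
    n = t ℕ.* suc k
    two^n = pow (1# + 1#) n
    combine : const two^n *ₚ (const (pow (- 1#) t) *ₚ W ^ₚ t) ≋ const (two^n * pow (- 1#) t) *ₚ W ^ₚ t
    combine = P.trans (P.sym (P.*-assoc (const two^n) (const (pow (- 1#) t)) (W ^ₚ t)))
      (P.*-congʳ {W ^ₚ t} (const-homo-* two^n (pow (- 1#) t)))
    powers : (W ^ₚ t) ^ₚ i ≋ monomial q 0 (replicate (suc k) (t ℕ.* i))
    powers = P.trans (^-assocʳ W t i) (P.sym (P.trans (P.*-identityˡ _) (w-replicate q (t ℕ.* i) (suc k))))

  doubles-scale : ∀ {q} a {f : ℕ → Carrier} → Doubles f q → Doubles (λ q → a * f q) q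
  doubles-scale a (doubling df) = doubling (trans (*-congˡ df) (distribˡ a _ _))

  sum-replicate : ∀ k x → sum (replicate k x) ≡ k ℕ.* x
  sum-replicate zero x = ≡.refl
  sum-replicate (suc k) x = ≡.cong (x ℕ.+_) (sum-replicate k x)

  -- Each of the k + 1 exponents equals t i, so the initial weight is (k + 1) t i = n i. Thus 2d ≤ n
  -- i throughout, whence the floor of n i / 2.
  rootSum-H-doubles : ∀ q n i k → n ℕ.* i / 2 ℕ.+ 2 ≤ D q → suc k ∣ n →
    Doubles (λ q → rootSum (H q k) (multiplierₚ q n ^ₚ i)) q
  rootSum-H-doubles q n i k le (divides t ≡.refl) = doubles-resp (λ q _ → rootSum-multiplier q k t i)
    (doubles-scale (scale n t i) (monomial-doubles q (n ℕ.* i)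
      (λ d 2d≤ → ℕₚ.≤-trans (ℕₚ.+-monoˡ-≤ 2 (half d 2d≤)) le) k
      (replicate (suc k) (t ℕ.* i)) 0 (Listₚ.length-replicate (suc k))
      (ℕₚ.≤-reflexive (≡.trans (sum-replicate (suc k) (t ℕ.* i)) (eq k t i)))))
    where
    half : ∀ d → 2 ℕ.* d ≤ n ℕ.* i → d ≤ n ℕ.* i / 2
    half d 2d≤ = ℕₚ.≤-trans (ℕₚ.≤-reflexive (≡.sym (m*n/n≡m d 2)))
      (/-monoˡ-≤ 2 (ℕₚ.≤-trans (ℕₚ.≤-reflexive (ℕₚ.*-comm d 2)) 2d≤))
    eq : ∀ k t i → suc k ℕ.* (t ℕ.* i) ≡ t ℕ.* suc k ℕ.* i
    eq = ℕSolver.solve-∀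

  -- If n ∣ m − 1 then λ_{m,n} contains the factor a_{m+n−1}, which a_k divides for every k ∣ n.

  rootSum-A-multiplier : ∀ q n i k → 1 ≤ n → 1 ≤ i → suc k ∣ n → n ∣ suc q →
    rootSum (A k) (multiplierₚ q n ^ₚ i) ≈ 0#
  rootSum-A-multiplier q n@(suc n′) (suc i) k _ _ k∣n n∣q = trans
    (rootSum-~ (~0-*ˡ (multiplierₚ q n ^ₚ i) multiplier~0))
    (trans (rootSum-cong (A k) {[]} {[] *ₚ b k} P.refl) (rootSum-multiple (A k) []))
    where
    open Congruence (A k)
    a-period : ∀ x → aₚ (x ℕ.+ suc k) ~ aₚ x
    a-period zero = congruent oneₚ (P.trans (P.reflexive (≡.sym (b≡a k))) (P.sym (P.*-identityˡ (b k))))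
    a-period (suc x) = ~-+ (~-* (a-period x) (a-period x)) (~-reflexive (P.refl {Xₚ}))
    a-multiple : ∀ s → aₚ (s ℕ.* suc k) ~ []
    a-multiple zero = ~-reflexive P.refl
    a-multiple (suc s) = ~-trans (~-reflexive (P.reflexive (≡.cong aₚ (ℕₚ.+-comm (suc k) (s ℕ.* suc k)))))
      (~-trans (a-period (s ℕ.* suc k)) (a-multiple s))
    orbit~0 : orbit q n′ ~ []
    orbit~0 with ∣m∣n⇒∣m+n k∣n (∣-trans k∣n n∣q)
    ... | divides s eq = ~-trans (~-reflexive (P.reflexive (≡.trans (b≡a (n′ ℕ.+ suc q)) (≡.cong aₚ eq)))) (a-multiple s)
    multiplier~0 : multiplierₚ q n ~ []
    multiplier~0 = ~-trans (~-reflexive (P.trans (multiplierₚ-orbit q n)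
      (S.solve 3 (λ u x y → u S.:* (x S.:* y) S.:= x S.:* (u S.:* y)) P.refl (const (pow (1# + 1#) n)) (orbit q n′) (prodTo (orbit q) n′))))
      (~0-*ˡ (const (pow (1# + 1#) n) *ₚ prodTo (orbit q) n′) orbit~0)

  extraᴹ : ℕ → ℕ → List ℕ → Monic
  extraᴹ q n js = if does (n ∣? suc q) then prodᴹ (map A js) else monic-1

  -- Numerator and denominator of G have one shape with the two divisor lists exchanged, so a single
  -- doubling lemma serves both.
  fractionᴹ : ℕ → ℕ → List ℕ → List ℕ → Monic
  fractionᴹ q n js ks = prodᴹ (map (H q) js) · extraᴹ q n ks

  numᴹ denᴹ : ℕ → ℕ → Monic
  numᴹ q n = fractionᴹ q n (divIdxμ+ n) (divIdxμ- n)
  denᴹ q n = fractionᴹ q n (divIdxμ- n) (divIdxμ+ n)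

  pol-prodᴹ : ∀ {F : ℕ → Monic} {f : ℕ → Pol} → (∀ j → pol (F j) ≋ f j) → ∀ js → pol (prodᴹ (map F js)) ≋ prodₚ (map f js)
  pol-prodᴹ e [] = P.refl
  pol-prodᴹ e (j ∷ js) = P.*-cong (e j) (pol-prodᴹ e js)

  pol-H : ∀ q j → pol (H q j) ≋ factorₚ (2 ℕ.+ q) j
  pol-H q j = P.reflexive (≡.cong₂ _+ₚ_
    (≡.trans (b≡a (suc j ℕ.+ q)) (≡.cong (λ n → aₚ (2 ℕ.+ n)) (ℕₚ.+-comm j q))) (b≡a q))

  pol-extra : ∀ q n js → pol (extraᴹ q n js) ≋ extraₚ (2 ℕ.+ q) n js
  pol-extra q n js with does (n ∣? suc q)
  ... | true = pol-prodᴹ (λ j → P.reflexive (b≡a j)) js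
  ... | false = P.refl

  pol-fraction : ∀ q n js ks → pol (fractionᴹ q n js ks) ≋ prodₚ (map (factorₚ (2 ℕ.+ q)) js) *ₚ extraₚ (2 ℕ.+ q) n ks
  pol-fraction q n js ks = P.*-cong (pol-prodᴹ (pol-H q) js) (pol-extra q n ks)

  sumBy-zero : ∀ {f : ℕ → Carrier} {js} → All (λ j → f j ≈ 0#) js → sumBy f js ≈ 0#
  sumBy-zero [] = refl
  sumBy-zero (e ∷ es) = trans (+-cong e (sumBy-zero es)) (+-identityˡ 0#)

  doubles-sumBy : ∀ {q} {f : ℕ → ℕ → Carrier} {js} → All (λ j → Doubles (f j) q) js → Doubles (λ q → sumBy (λ j → f j q) js) q
  doubles-sumBy [] = doubling (sym (+-identityˡ 0#))
  doubles-sumBy (d ∷ ds) = doubles-+ d (doubles-sumBy ds)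

  module _ (n i : ℕ) (1≤n : 1 ≤ n) (1≤i : 1 ≤ i) where

    Divisors : List ℕ → Set
    Divisors = All (λ j → suc j ∣ n)

    -- The truth of n ∣ m - 1 may change from m to m + 1; the comparison survives because the
    -- contribution is 0 either way.
    rootSum-extra : ∀ q {ks} → Divisors ks → rootSum (extraᴹ q n ks) (multiplierₚ q n ^ₚ i) ≈ 0#
    rootSum-extra q {ks} ds with n ∣? suc q
    ... | yes n∣q = trans (rootSum-prod A ks (multiplierₚ q n ^ₚ i))
      (sumBy-zero (All.map (λ {k} k∣n → rootSum-A-multiplier q n i k 1≤n 1≤i k∣n n∣q) ds))
    ... | no _ = rootSum-1 (multiplierₚ q n ^ₚ i)

    fraction-doubles : ∀ q {js ks} → n ℕ.* i / 2 ℕ.+ 2 ≤ D q → Divisors js → Divisors ks →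
      Doubles (λ q → rootSum (fractionᴹ q n js ks) (multiplierₚ q n ^ₚ i)) q
    fraction-doubles q {js} {ks} le djs dks = doubles-resp
      (λ q _ → trans (rootSum-· (prodᴹ (map (H q) js)) (extraᴹ q n ks) (multiplierₚ q n ^ₚ i))
        (trans (+-cong (rootSum-prod (H q) js (multiplierₚ q n ^ₚ i)) (rootSum-extra q dks)) (+-identityʳ _)))
      (doubles-sumBy (All.map (λ {k} → rootSum-H-doubles q n i k le) djs))

    divisors+ : Divisors (divIdxμ+ n)
    divisors+ = Allₚ.filter⁺ _ (Allₚ.all-filter (λ j → suc j ∣? n) (upTo n))

    divisors- : Divisors (divIdxμ- n)
    divisors- = Allₚ.filter⁺ _ (Allₚ.all-filter (λ j → suc j ∣? n) (upTo n))

    difference : ℕ → Carrier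
    difference q = rootSum (numᴹ q n) (multiplierₚ q n ^ₚ i) + - rootSum (denᴹ q n) (multiplierₚ q n ^ₚ i)

    difference-doubles : ∀ q → n ℕ.* i / 2 ℕ.+ 2 ≤ D q → Doubles difference q
    difference-doubles q le = doubles-+ (fraction-doubles q le divisors+ divisors-)
      (doubles-neg (fraction-doubles q le divisors- divisors+))

    -- The denominator is cancelled after taking root sums: additivity is applied to the equation ∏
    -- (c - αⱼ) · Den = Num.
    powerSum-multipliers : ¬ 1# ≈ 0# → ∀ q αs → RootsOfG (2 ℕ.+ q) n αs →
      powerSum (map (multiplier (2 ℕ.+ q) n) αs) i ≈ difference q
    powerSum-multipliers 1≉0 q αs rts = begin
      powerSum (map (multiplier (2 ℕ.+ q) n) αs) i    ≈⟨ powerSum-map αs ⟩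
      sumBy (eval (g ^ₚ i)) αs                        ≈⟨ rootSum-roots αs (g ^ₚ i) ⟨
      rootSum (roots αs) (g ^ₚ i)                     ≈⟨ solve 2 (λ x y → x := x :+ y :+ :- y) refl _ _ ⟩
      rootSum (roots αs) (g ^ₚ i) + rootSum (denᴹ q n) (g ^ₚ i) + - rootSum (denᴹ q n) (g ^ₚ i)
        ≈⟨ +-congʳ (trans (sym (rootSum-· (roots αs) (denᴹ q n) (g ^ₚ i))) (rootSum-resp 1≉0 (roots αs · denᴹ q n) (numᴹ q n) (g ^ₚ i) num)) ⟩
      difference q                                    ∎
      where
      open import Relation.Binary.Reasoning.Setoid setoid
      g = multiplierₚ q n
      num : pol (roots αs) *ₚ pol (denᴹ q n) ≋ pol (numᴹ q n)
      num = P.trans (P.*-cong (P.reflexive (pol-roots αs)) (pol-fraction q n (divIdxμ- n) (divIdxμ+ n)))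
        (P.trans (coeffwise rts) (P.sym (pol-fraction q n (divIdxμ+ n) (divIdxμ- n))))
      powerSum-map : ∀ αs → powerSum (map (multiplier (2 ℕ.+ q) n) αs) i ≈ sumBy (eval (g ^ₚ i)) αs
      powerSum-map [] = refl
      powerSum-map (α ∷ αs) = +-cong (sym (trans (eval-^ g i α) (pow-cong i (eval-multiplier q n α)))) (powerSum-map αs)

  powerSum-++ : ∀ xs ys i → powerSum (xs ++ ys) i ≈ powerSum xs i + powerSum ys i
  powerSum-++ [] ys i = sym (+-identityˡ _)
  powerSum-++ (x ∷ xs) ys i = trans (+-congˡ (powerSum-++ xs ys i)) (sym (+-assoc _ _ _))

  prodₚ-++ : ∀ ps rs → prodₚ (ps ++ rs) ≋ prodₚ ps *ₚ prodₚ rs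
  prodₚ-++ [] rs = P.sym (P.*-identityˡ _)
  prodₚ-++ (p ∷ ps) rs = P.trans (P.*-congˡ {p} (prodₚ-++ ps rs)) (P.sym (P.*-assoc p _ _))

  coeffTop-cong : ∀ {p r} d i → p ≋ r → coeffTop p d i ≈ coeffTop r d i
  coeffTop-cong d i e with i ℕ.≤ᵇ d
  ... | true = at e (d ℕ.∸ i)
  ... | false = refl

  Pmult-roots : ∀ m n αs → Pmult m n αs ≡ prodₚ (map X-_ (map (multiplier m n) αs))
  Pmult-roots m n αs = ≡.cong prodₚ (Listₚ.map-∘ αs)

  Pmult-square : ∀ m n αs → let xs = map (multiplier m n) αs in
    Pmult m n αs *ₚ Pmult m n αs ≋ prodₚ (map X-_ (xs ++ xs))
  Pmult-square m n αs = P.trans (P.*-cong e e) (P.sym (P.trans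
    (P.reflexive (≡.cong prodₚ (Listₚ.map-++ X-_ xs xs))) (prodₚ-++ (map X-_ xs) (map X-_ xs))))
    where
    xs = map (multiplier m n) αs
    e = P.reflexive (Pmult-roots m n αs)

-- Comparison of the coefficients for m and m + 1.

open import Data.Nat using (_+_; _*_; _^_; _∸_)

theorem3p1 : ∀ {c ℓ : Level} (R : CommutativeRing c ℓ) →
    let module P = Poly R in
    P.IsIntegralDomain → P.CharZero →
    (m n : ℕ) → 2 ≤ m → 1 ≤ n →
    (αs βs : List P.Carrier) → P.RootsOfG m n αs → P.RootsOfG (suc m) n βs →
    (i : ℕ) → 1 ≤ i → (n * i) / 2 + 2 ≤ 2 ^ (m ∸ 2) →
    P.coeffTop (P._*ₚ_ (P.Pmult m n αs) (P.Pmult m n αs)) (2 * length αs) i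
    P.≈ P.coeffTop (P.Pmult (suc m) n βs) (length βs) i
theorem3p1 R isDomain charZero (suc (suc q)) n (s≤s (s≤s z≤n)) 1≤n αs βs rα rβ i 1≤i le = begin
  coeffTop (Pmult m n αs *ₚ Pmult m n αs) (2 * length αs) i
    ≈⟨ coeffTop-cong (2 * length αs) i (Pmult-square m n αs) ⟩
  coeffTop (prodₚ (map X-_ (xs ++ xs))) (2 * length αs) i
    ≡⟨ ≡.cong (λ d → coeffTop (prodₚ (map X-_ (xs ++ xs))) d i) length-xs ⟩
  coeffTop (prodₚ (map X-_ (xs ++ xs))) (length (xs ++ xs)) i
    ≈⟨ coeffTop-roots (xs ++ xs) i ⟩
  elem (xs ++ xs) i
    ≈⟨ powerSums⇒elem isDomain charZero (xs ++ xs) ys i sums i ℕₚ.≤-refl ⟩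
  elem ys i
    ≈⟨ coeffTop-roots ys i ⟨
  coeffTop (prodₚ (map X-_ ys)) (length ys) i
    ≡⟨ ≡.cong₂ (λ p d → coeffTop p d i) (≡.sym (Pmult-roots (suc m) n βs)) (Listₚ.length-map (multiplier (suc m) n) βs) ⟩
  coeffTop (Pmult (suc m) n βs) (length βs) i ∎
  where
  open Poly R hiding (zero; _*_; _+_)
  open PolynomialRing R
  open CriticalOrbit R using (D; D≡2^; doubled)
  open NewtonIdentities R
  open Multipliers R
  open import Relation.Binary.Reasoning.Setoid setoid
  m = suc (suc q)
  xs = map (multiplier m n) αs
  ys = map (multiplier (suc m) n) βs

  length-xs : 2 * length αs ≡ length (xs ++ xs)
  length-xs = ≡.sym (≡.trans (Listₚ.length-++ xs) (≡.cong₂ _+_ len (≡.trans len (≡.sym (ℕₚ.+-identityʳ _)))))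
    where len = Listₚ.length-map (multiplier m n) αs

  sums : ∀ j → 1 ≤ j → j ≤ i → powerSum (xs ++ xs) j ≈ powerSum ys j
  sums j 1≤j j≤i = begin
    powerSum (xs ++ xs) j                           ≈⟨ powerSum-++ xs xs j ⟩
    Poly._+_ R (powerSum xs j) (powerSum xs j)      ≈⟨ +-cong α-sum α-sum ⟩
    Poly._+_ R (difference n j 1≤n 1≤j q) (difference n j 1≤n 1≤j q) ≈⟨ doubled (difference-doubles n j 1≤n 1≤j q bound-j) ⟨
    difference n j 1≤n 1≤j (suc q)                  ≈⟨ powerSum-multipliers n j 1≤n 1≤j (proj₁ isDomain) (suc q) βs rβ ⟨
    powerSum ys j                                   ∎
    where
    α-sum = powerSum-multipliers n j 1≤n 1≤j (proj₁ isDomain) q αs rα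
    bound-j : n * j / 2 + 2 ≤ D q
    bound-j = ℕₚ.≤-trans (ℕₚ.+-monoˡ-≤ 2 (/-monoˡ-≤ 2 (ℕₚ.*-monoʳ-≤ n j≤i)))
      (ℕₚ.≤-trans le (ℕₚ.≤-reflexive (≡.sym (D≡2^ q))))
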